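{- Let $T(n)$ denote the number of fixed polyiamonds with $n$ cells. If $\ell,m\ge 1$ are positive integers that are not both equal to $1$, then $T(\ell+m)\ge T(\ell)\,T(m)$.
   Context: The triangular lattice is the tiling of the plane by equilateral triangles; its cells come in two orientations. A polyiamond with $n$ cells is a finite set of $n$ cells of the triangular lattice that is edge-connected, i.e. the graph on the cells in which two cells are adjacent when they share an edge is connected. Two polyiamonds are considered the same if one is a translate of the other (no rotations or reflections allowed); $T(n)$ is the number of such translation classes of polyiamonds with $n$ cells. For example $T(1)=2$, $T(2)=3$, $T(3)=6$. -}

module Defs where

open import Data.Fin.Base using (Fin)
open import Data.Fin.Properties using (injective⇒≤)
open import Data.Integer.Base as ℤ using (ℤ; 0ℤ; 1ℤ)
import Data.Integer.Properties as ℤ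
open import Data.List.Base using (List; []; _∷_; length; map; concatMap; lookup; deduplicate)
open import Data.List.Membership.Propositional using (_∈_; _∉_; find; lose)
open import Data.List.Membership.Propositional.Properties
  using (∈-map⁺; ∈-map⁻; ∈-concatMap⁺; ∈-lookup; ∈-deduplicate⁺)
open import Data.List.Membership.Setoid.Properties using (index-injective)
open import Data.List.Properties using (length-map)
open import Data.List.Relation.Unary.All as All using (All; []; _∷_)
open import Data.List.Relation.Unary.All.Properties using (¬Any⇒All¬; ¬All⇒Any¬)
open import Data.List.Relation.Unary.AllPairs using ([]; _∷_)
open import Data.List.Relation.Unary.Any as Any using (Any; here; there; any?; index)
open import Data.List.Relation.Unary.Enumerates.Setoid using (IsEnumeration)
open import Data.List.Relation.Unary.Enumerates.Setoid.Properties
  using (lookup-surjective) renaming (deduplicate⁺ to enumerates-deduplicate⁺)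
import Data.List.Relation.Unary.Unique.Setoid as SetoidUnique
open import Data.List.Relation.Unary.Unique.DecSetoid.Properties using (deduplicate-!)
open import Data.List.Relation.Unary.Unique.Propositional using (Unique)
import Data.List.Relation.Unary.Unique.Propositional.Properties as Unique
open import Data.Nat.Base using (ℕ; zero; suc; _≤_; _<_)
import Data.Nat.Properties as ℕ
open import Data.Product.Base using (∃; ∃₂; _×_; _,_; proj₁; proj₂)
open import Data.Product.Properties using (≡-dec)
open import Function.Base using (_∘_)
open import Function.Bundles using (_⇔_; mk⇔; Bijection; module Equivalence)
open import Relation.Binary.Bundles using (Setoid; DecSetoid)
open import Relation.Binary.Construct.Closure.ReflexiveTransitive as Star using (Star; ε; _◅_; _◅◅_)
open import Relation.Binary.Definitions using (DecidableEquality; Symmetric)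
open import Relation.Binary.PropositionalEquality
open import Relation.Nullary using (¬_; Dec; yes; no; ¬?; contradiction; _×-dec_; map′)
open import Relation.Nullary.Decidable using (decidable-stable)

-- (x , y) is the point x e₁ + y e₂, where e₁ and e₂ are unit vectors at
-- an angle of 60°.
Point : Set
Point = ℤ × ℤ

infixl 6 _⊕_
_⊕_ : Point → Point → Point
(x , y) ⊕ (x′ , y′) = x ℤ.+ x′ , y ℤ.+ y′

⊖_ : Point → Point
⊖ (x , y) = ℤ.- x , ℤ.- y

0ᵖ e₁ e₂ : Point
0ᵖ = 0ℤ , 0ℤ
e₁ = 1ℤ , 0ℤ
e₂ = 0ℤ , 1ℤ

data Orientation : Set where
  up down : Orientation

-- The vectors e₁ and e₂ based at p span a rhombus, which its short
-- diagonal cuts into the cells (p , up) and (p , down).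
Cell : Set
Cell = Point × Orientation

corners : Cell → List Point
corners (p , up)   = p           ∷ p ⊕ e₁ ∷ p ⊕ e₂ ∷ []
corners (p , down) = p ⊕ e₁ ⊕ e₂ ∷ p ⊕ e₁ ∷ p ⊕ e₂ ∷ []

-- Two distinct cells share an edge when they share both of its ends.
Adjacent : Cell → Cell → Set
Adjacent c d = c ≢ d × ∃₂ λ u v → u ≢ v ×
  (u ∈ corners c × v ∈ corners c) × (u ∈ corners d × v ∈ corners d)

translate : Point → Cell → Cell
translate v (p , o) = v ⊕ p , o

AdjacentIn : List Cell → Cell → Cell → Set
AdjacentIn cs c d = c ∈ cs × d ∈ cs × Adjacent c d

Connected : List Cell → Set
Connected cs = ∀ {c d} → c ∈ cs → d ∈ cs → Star (AdjacentIn cs) c d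

record Polyiamond (n : ℕ) : Set where
  field
    cells     : List Cell
    unique    : Unique cells
    size      : length cells ≡ n
    connected : Connected cells

open Polyiamond public

-- The order in which the cells are listed is irrelevant, hence the
-- comparison by membership.
infix 4 _≈_
_≈_ : ∀ {n} → Polyiamond n → Polyiamond n → Set
P ≈ Q = ∃ λ v → ∀ c → c ∈ cells P ⇔ translate v c ∈ cells Q

⊕-assoc : ∀ u v w → (u ⊕ v) ⊕ w ≡ u ⊕ (v ⊕ w)
⊕-assoc (a , b) (c , d) (e , f) = cong₂ _,_ (ℤ.+-assoc a c e) (ℤ.+-assoc b d f)

⊕-comm : ∀ u v → u ⊕ v ≡ v ⊕ u
⊕-comm (a , b) (c , d) = cong₂ _,_ (ℤ.+-comm a c) (ℤ.+-comm b d)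

⊕-identityˡ : ∀ u → 0ᵖ ⊕ u ≡ u
⊕-identityˡ (a , b) = cong₂ _,_ (ℤ.+-identityˡ a) (ℤ.+-identityˡ b)

⊕-inverseˡ : ∀ u → (⊖ u) ⊕ u ≡ 0ᵖ
⊕-inverseˡ (a , b) = cong₂ _,_ (ℤ.+-inverseˡ a) (ℤ.+-inverseˡ b)

⊕-inverseʳ : ∀ u → u ⊕ (⊖ u) ≡ 0ᵖ
⊕-inverseʳ (a , b) = cong₂ _,_ (ℤ.+-inverseʳ a) (ℤ.+-inverseʳ b)

⊖-⊕-cancel : ∀ u v → (⊖ u) ⊕ (u ⊕ v) ≡ v
⊖-⊕-cancel u v = trans (sym (⊕-assoc (⊖ u) u v))
  (trans (cong (_⊕ v) (⊕-inverseˡ u)) (⊕-identityˡ v))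

⊕-⊖-cancel : ∀ u v → u ⊕ ((⊖ u) ⊕ v) ≡ v
⊕-⊖-cancel u v = trans (sym (⊕-assoc u (⊖ u) v))
  (trans (cong (_⊕ v) (⊕-inverseʳ u)) (⊕-identityˡ v))

⊕-cancelʳ : ∀ u v → (u ⊕ v) ⊕ (⊖ v) ≡ u
⊕-cancelʳ u v = trans (⊕-comm (u ⊕ v) (⊖ v))
  (trans (cong ((⊖ v) ⊕_) (⊕-comm u v)) (⊖-⊕-cancel v u))

⊕-injective : ∀ u {v w} → u ⊕ v ≡ u ⊕ w → v ≡ w
⊕-injective u eq = trans (sym (⊖-⊕-cancel u _)) (trans (cong ((⊖ u) ⊕_) eq) (⊖-⊕-cancel u _))

translate-0ᵖ : ∀ c → translate 0ᵖ c ≡ c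
translate-0ᵖ (p , o) = cong (_, o) (⊕-identityˡ p)

translate-⊕ : ∀ u v c → translate (u ⊕ v) c ≡ translate u (translate v c)
translate-⊕ u v (p , o) = cong (_, o) (⊕-assoc u v p)

translate-⊖ˡ : ∀ v c → translate (⊖ v) (translate v c) ≡ c
translate-⊖ˡ v (p , o) = cong (_, o) (⊖-⊕-cancel v p)

translate-⊖ʳ : ∀ v c → translate v (translate (⊖ v) c) ≡ c
translate-⊖ʳ v (p , o) = cong (_, o) (⊕-⊖-cancel v p)

translate-injective : ∀ v {c d} → translate v c ≡ translate v d → c ≡ d
translate-injective v eq =
  trans (sym (translate-⊖ˡ v _)) (trans (cong (translate (⊖ v)) eq) (translate-⊖ˡ v _))

corners-translate : ∀ v c → corners (translate v c) ≡ map (v ⊕_) (corners c)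
corners-translate v (p , up) =
  cong₂ (λ a b → v ⊕ p ∷ a ∷ b ∷ []) (⊕-assoc v p e₁) (⊕-assoc v p e₂)
corners-translate v (p , down) =
  trans (cong (λ a → (v ⊕ p) ⊕ e₁ ⊕ e₂ ∷ (v ⊕ p) ⊕ e₁ ∷ a ∷ []) (⊕-assoc v p e₂))
        (cong₂ (λ a b → a ∷ b ∷ v ⊕ (p ⊕ e₂) ∷ [])
          (trans (cong (_⊕ e₂) (⊕-assoc v p e₁)) (⊕-assoc v (p ⊕ e₁) e₂))
          (⊕-assoc v p e₁))

adjacent-translate : ∀ v {c d} → Adjacent c d → Adjacent (translate v c) (translate v d)
adjacent-translate v {c} {d} (c≢d , p , q , p≢q , (p∈c , q∈c) , (p∈d , q∈d)) =
  c≢d ∘ translate-injective v , v ⊕ p , v ⊕ q , p≢q ∘ ⊕-injective v ,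
  (shift c p∈c , shift c q∈c) , (shift d p∈d , shift d q∈d)
  where
  shift : ∀ c {p} → p ∈ corners c → v ⊕ p ∈ corners (translate v c)
  shift c p∈ = subst (_ ∈_) (sym (corners-translate v c)) (∈-map⁺ (v ⊕_) p∈)

adjacent-sym : Symmetric Adjacent
adjacent-sym (c≢d , u , v , u≢v , inC , inD) = c≢d ∘ sym , u , v , u≢v , inD , inC

≈-refl : ∀ {n} {P : Polyiamond n} → P ≈ P
≈-refl {P = P} = 0ᵖ , λ c → mk⇔ (subst (_∈ cells P) (sym (translate-0ᵖ c)))
                                (subst (_∈ cells P) (translate-0ᵖ c))

≈-sym : ∀ {n} {P Q : Polyiamond n} → P ≈ Q → Q ≈ P
≈-sym {P = P} {Q} (v , f) = ⊖ v , λ c → mk⇔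
  (λ c∈Q → Equivalence.from (f _) (subst (_∈ cells Q) (sym (translate-⊖ʳ v c)) c∈Q))
  (λ c∈P → subst (_∈ cells Q) (translate-⊖ʳ v c) (Equivalence.to (f _) c∈P))

≈-trans : ∀ {n} {P Q R : Polyiamond n} → P ≈ Q → Q ≈ R → P ≈ R
≈-trans {R = R} (v , f) (w , g) = w ⊕ v , λ c → mk⇔
  (λ c∈P → subst (_∈ cells R) (sym (translate-⊕ w v c)) (Equivalence.to (g _) (Equivalence.to (f c) c∈P)))
  (λ c∈R → Equivalence.from (f c) (Equivalence.from (g _) (subst (_∈ cells R) (translate-⊕ w v c) c∈R)))

FixedPolyiamonds : ℕ → Setoid _ _
FixedPolyiamonds n = record
  { Carrier       = Polyiamond n
  ; _≈_           = _≈_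
  ; isEquivalence = record
    { refl  = λ {P} → ≈-refl {P = P}
    ; sym   = λ {P} {Q} → ≈-sym {P = P} {Q}
    ; trans = λ {P} {Q} {R} → ≈-trans {P = P} {Q} {R}
    }
  }

_≟ᵖ_ : DecidableEquality Point
_≟ᵖ_ = ≡-dec ℤ._≟_ ℤ._≟_

_≟ᵒ_ : DecidableEquality Orientation
up   ≟ᵒ up   = yes refl
up   ≟ᵒ down = no λ ()
down ≟ᵒ up   = no λ ()
down ≟ᵒ down = yes refl

_≟ᶜ_ : DecidableEquality Cell
_≟ᶜ_ = ≡-dec _≟ᵖ_ _≟ᵒ_

open import Data.List.Membership.DecPropositional _≟ᵖ_ using () renaming (_∈?_ to _∈ᵖ?_)
open import Data.List.Membership.DecPropositional _≟ᶜ_ using (_∈?_)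

adjacent? : ∀ c d → Dec (Adjacent c d)
adjacent? c d = ¬? (c ≟ᶜ d) ×-dec map′
  (λ a → let (u , u∈c , b) = find a
             (v , v∈c , u≢v , u∈d , v∈d) = find {P = Ends u} b
         in u , v , u≢v , (u∈c , v∈c) , (u∈d , v∈d))
  (λ (u , v , u≢v , (u∈c , v∈c) , (u∈d , v∈d)) → lose u∈c (lose v∈c (u≢v , u∈d , v∈d)))
  (any? (λ u → any? (ends? u) (corners c)) (corners c))
  where
  Ends : Point → Point → Set
  Ends u v = u ≢ v × u ∈ corners d × v ∈ corners d

  ends? : ∀ u v → Dec (Ends u v)
  ends? u v = ¬? (u ≟ᵖ v) ×-dec u ∈ᵖ? corners d ×-dec v ∈ᵖ? corners d

lookup-injective : ∀ {a ℓ} (S : Setoid a ℓ) {xs} → SetoidUnique.Unique S xs →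
                   ∀ i j → Setoid._≈_ S (lookup xs i) (lookup xs j) → i ≡ j
lookup-injective S (_ ∷ _)   Fin.zero    Fin.zero    _  = refl
lookup-injective S (x∉ ∷ _)  Fin.zero    (Fin.suc j) eq = contradiction eq (All.lookup x∉ (∈-lookup j))
lookup-injective S (x∉ ∷ _)  (Fin.suc i) Fin.zero    eq =
  contradiction (Setoid.sym S eq) (All.lookup x∉ (∈-lookup i))
lookup-injective S (_ ∷ xs!) (Fin.suc i) (Fin.suc j) eq = cong Fin.suc (lookup-injective S xs! i j eq)

unique-⊆⇒length≤ : ∀ {xs ys : List Cell} → Unique xs → (∀ {c} → c ∈ xs → c ∈ ys) →
                   length xs ≤ length ys
unique-⊆⇒length≤ {xs} {ys} xs! xs⊆ys =
  injective⇒≤ {f = λ i → index (xs⊆ys (∈-lookup {xs = xs} i))} λ {i} {j} eq →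
    lookup-injective (setoid Cell) xs! i j (index-injective (setoid Cell) (xs⊆ys (∈-lookup i)) (xs⊆ys (∈-lookup j)) eq)

_⊑[_]_ : ∀ {m n} → Polyiamond m → Point → Polyiamond n → Set
P ⊑[ v ] Q = ∀ c → c ∈ cells P → translate v c ∈ cells Q

translated : ∀ {n} → Point → Polyiamond n → List Cell
translated v P = map (translate v) (cells P)

⊑⇒≈ : ∀ {n} (P Q : Polyiamond n) v → P ⊑[ v ] Q → P ≈ Q
⊑⇒≈ {n} P Q v P⊑Q = v , λ c → mk⇔ (P⊑Q c) λ c∈Q →
  let (d , d∈P , eq) = ∈-map⁻ (translate v) (Q⊆P c∈Q)
  in subst (_∈ cells P) (sym (translate-injective v eq)) d∈P
  where
  Q⊆P : ∀ {c} → c ∈ cells Q → c ∈ translated v P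
  Q⊆P {c} c∈Q = decidable-stable (c ∈? translated v P) λ c∉P →
    ℕ.1+n≰n (subst₂ (λ a b → suc a ≤ b) (trans (length-map _ (cells P)) (size P)) (size Q)
      (unique-⊆⇒length≤ {c ∷ translated v P}
        (¬Any⇒All¬ _ c∉P ∷ Unique.map⁺ (translate-injective v) (unique P))
        λ { (here refl) → c∈Q
          ; (there d∈)  → let (_ , b∈P , eq) = ∈-map⁻ (translate v) d∈
                          in subst (_∈ cells Q) (sym eq) (P⊑Q _ b∈P) }))

_⊑?_ : ∀ {m n} (P : Polyiamond (suc m)) (Q : Polyiamond n) → Dec (∃ λ v → P ⊑[ v ] Q)
P@record { cells = c@(p , o) ∷ cs } ⊑? Q = map′
  (λ a → let (c , _ , b) = find a in proj₁ c ⊕ (⊖ p) , λ _ → All.lookup b)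
  (λ (v , f) → lose (f c (here refl))
    (All.tabulate λ {d} d∈ → subst (λ w → translate w d ∈ cells Q) (sym (⊕-cancelʳ v p)) (f d d∈)))
  (any? (λ (q , _) → All.all? (λ d → translate (q ⊕ (⊖ p)) d ∈? cells Q) (cells P)) (cells Q))

_≈?_ : ∀ {n} (P Q : Polyiamond n) → Dec (P ≈ Q)
_≈?_ {zero}  P Q with cells P | size P | cells Q | size Q
... | [] | _ | [] | _ = yes (0ᵖ , λ c → mk⇔ (λ ()) λ ())
_≈?_ {suc n} P Q = map′ (λ (v , f) → ⊑⇒≈ P Q v f) (λ (v , f) → v , λ c → Equivalence.to (f c)) (P ⊑? Q)

FixedPolyiamonds-dec : ℕ → DecSetoid _ _
FixedPolyiamonds-dec n = record
  { Carrier          = Polyiamond n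
  ; _≈_              = _≈_
  ; isDecEquivalence = record
    { isEquivalence = Setoid.isEquivalence (FixedPolyiamonds n)
    ; _≟_           = _≈?_
    }
  }

empty : Polyiamond 0
empty = record { cells = [] ; unique = [] ; size = refl ; connected = λ () }

single : Cell → Polyiamond 1
single c = record
  { cells     = c ∷ []
  ; unique    = [] ∷ []
  ; size      = refl
  ; connected = λ { (here refl) (here refl) → ε }
  }

extend : ∀ {n} (P : Polyiamond n) c → c ∉ cells P → Any (λ s → Adjacent s c) (cells P) →
         Polyiamond (suc n)
extend P c c∉P adj = record
  { cells     = c ∷ cells P
  ; unique    = ¬Any⇒All¬ _ c∉P ∷ unique P
  ; size      = cong suc (size P)
  ; connected = conn
  }
  where
  s   = proj₁ (find adj)
  s∈P = proj₁ (proj₂ (find adj))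
  s~c = proj₂ (proj₂ (find adj))

  weaken : ∀ {d e} → Star (AdjacentIn (cells P)) d e → Star (AdjacentIn (c ∷ cells P)) d e
  weaken = Star.map λ (d∈ , e∈ , d~e) → there d∈ , there e∈ , d~e

  conn : Connected (c ∷ cells P)
  conn (here refl) (here refl) = ε
  conn (here refl) (there e∈)  = (here refl , there s∈P , adjacent-sym s~c) ◅ weaken (connected P s∈P e∈)
  conn (there d∈)  (here refl) = weaken (connected P d∈ s∈P) ◅◅ (there s∈P , here refl , s~c) ◅ ε
  conn (there d∈)  (there e∈)  = weaken (connected P d∈ e∈)

-- The six cells with corner u.
around : Point → List Cell
around u = (u , up) ∷ (u ⊕ (⊖ e₁) , up) ∷ (u ⊕ (⊖ e₂) , up) ∷
           (u ⊕ (⊖ e₂) ⊕ (⊖ e₁) , down) ∷ (u ⊕ (⊖ e₁) , down) ∷ (u ⊕ (⊖ e₂) , down) ∷ []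

∈-around : ∀ {u} d → u ∈ corners d → d ∈ around u
∈-around (p , up) (here refl) = here refl
∈-around (p , up) (there (here refl)) = there (here (cong (_, up) (sym (⊕-cancelʳ p e₁))))
∈-around (p , up) (there (there (here refl))) =
  there (there (here (cong (_, up) (sym (⊕-cancelʳ p e₂)))))
∈-around (p , down) (here refl) =
  there (there (there (here (cong (_, down)
    (sym (trans (cong (_⊕ (⊖ e₁)) (⊕-cancelʳ (p ⊕ e₁) e₂)) (⊕-cancelʳ p e₁)))))))
∈-around (p , down) (there (here refl)) =
  there (there (there (there (here (cong (_, down) (sym (⊕-cancelʳ p e₁)))))))
∈-around (p , down) (there (there (here refl))) =
  there (there (there (there (there (here (cong (_, down) (sym (⊕-cancelʳ p e₂))))))))

candidates : ∀ {n} → Polyiamond n → List Cell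
candidates P = deduplicate _≟ᶜ_ (concatMap (concatMap around ∘ corners) (cells P))

extend? : ∀ {n} (P : Polyiamond n) c → Dec (c ∉ cells P × Any (λ s → Adjacent s c) (cells P))
extend? P c = ¬? (c ∈? cells P) ×-dec any? (λ s → adjacent? s c) (cells P)

extendAt : ∀ {n} → Polyiamond n → Cell → List (Polyiamond (suc n))
extendAt P c with extend? P c
... | yes (c∉P , adj) = extend P c c∉P adj ∷ []
... | no  _           = []

children : ∀ {n} → Polyiamond n → List (Polyiamond (suc n))
children P = concatMap (extendAt P) (candidates P)

grown : ∀ n → List (Polyiamond n)
grown 0             = empty ∷ []
grown 1             = single (0ᵖ , up) ∷ single (0ᵖ , down) ∷ []
grown (suc (suc n)) = concatMap children (grown (suc n))

leave : ∀ (B : List Cell) {cs c d} → Star (AdjacentIn cs) c d → c ∈ B → d ∉ B →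
        ∃₂ λ s t → s ∈ B × t ∉ B × t ∈ cs × Adjacent s t
leave B ε c∈B c∉B = contradiction c∈B c∉B
leave B (_◅_ {j = t} (_ , t∈cs , s~t) path) s∈B d∉B with t ∈? B
... | yes t∈B = leave B path t∈B d∉B
... | no  t∉B = _ , t , s∈B , t∉B , t∈cs , s~t

∈-children : ∀ {n} (P : Polyiamond n) {s c} → c ∉ cells P → s ∈ cells P → Adjacent s c →
             ∃ λ P′ → P′ ∈ children P × cells P′ ≡ c ∷ cells P
∈-children P {s} {c} c∉P s∈P s~c@(_ , _ , _ , _ , (u∈s , _) , (u∈c , _)) =
  let (P′ , P′∈ , eq) = ∈-extendAt
  in P′ , ∈-concatMap⁺ (extendAt P) (lose c∈candidates P′∈) , eq
  where
  c∈candidates : c ∈ candidates P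
  c∈candidates = ∈-deduplicate⁺ _≟ᶜ_ (∈-concatMap⁺ (concatMap around ∘ corners)
    (lose s∈P (∈-concatMap⁺ around (lose u∈s (∈-around c u∈c)))))

  ∈-extendAt : ∃ λ P′ → P′ ∈ extendAt P c × cells P′ ≡ c ∷ cells P
  ∈-extendAt with extend? P c
  ... | yes _   = _ , here refl , refl
  ... | no  ¬ok = contradiction (c∉P , lose s∈P s~c) ¬ok

-- Growing a translate of P inside Q avoids having to find a cell whose
-- removal leaves Q connected.
grown-⊑ : ∀ {n} (Q : Polyiamond n) k → k < n →
          ∃ λ P → P ∈ grown (suc k) × ∃ λ v → P ⊑[ v ] Q
grown-⊑ Q zero 0<n with cells Q | size Q
grown-⊑ Q zero () | [] | refl
... | (p , o) ∷ _ | _ = single (0ᵖ , o) , single∈ o , p , λ { _ (here refl) → here (cong (_, o) p⊕0) }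
  where
  single∈ : ∀ o → single (0ᵖ , o) ∈ grown 1
  single∈ up   = here refl
  single∈ down = there (here refl)

  p⊕0 : p ⊕ 0ᵖ ≡ p
  p⊕0 = trans (⊕-comm p 0ᵖ) (⊕-identityˡ p)
grown-⊑ {n} Q (suc k) k+1<n =
  let (P , P∈ , v , P⊑Q) = grown-⊑ Q k (ℕ.<-trans ℕ.≤-refl k+1<n)
      (P′ , P′∈ , P′⊑Q)  = step P v P⊑Q
  in P′ , ∈-concatMap⁺ children (lose P∈ P′∈) , v , P′⊑Q
  where
  step : ∀ (P : Polyiamond (suc k)) v → P ⊑[ v ] Q → ∃ λ P′ → P′ ∈ children P × P′ ⊑[ v ] Q
  step P@record { cells = b ∷ bs } v P⊑Q =
    let (d , d∈Q , d∉B)                       = find outside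
        (s′ , t , s′∈B , t∉B , t∈Q , s′~t) = leave B (connected Q (P⊑Q b (here refl)) d∈Q) (here refl) d∉B
        (s , s∈P , s′≡vs)                     = ∈-map⁻ (translate v) s′∈B
        s~t                                   = subst (λ x → Adjacent x (translate (⊖ v) t))
                                                  (trans (cong (translate (⊖ v)) s′≡vs) (translate-⊖ˡ v s))
                                                  (adjacent-translate (⊖ v) s′~t)
        (P′ , P′∈ , eq)                       = ∈-children P
                                                  (λ t∈P → t∉B (subst (_∈ B) (translate-⊖ʳ v t) (∈-map⁺ (translate v) t∈P)))
                                                  s∈P s~t
    in P′ , P′∈ , λ c c∈P′ → P′⊑Q t∈Q (subst (c ∈_) eq c∈P′)
    where
    B = translated v P

    outside : Any (_∉ B) (cells Q)
    outside = ¬All⇒Any¬ (_∈? B) (cells Q) (λ Q⊆B → ℕ.<⇒≱ k+1<n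
      (subst₂ _≤_ (size Q) (trans (length-map _ (cells P)) (size P))
        (unique-⊆⇒length≤ (unique Q) (All.lookup Q⊆B))))

    P′⊑Q : ∀ {t c} → t ∈ cells Q → c ∈ translate (⊖ v) t ∷ cells P → translate v c ∈ cells Q
    P′⊑Q {t} t∈Q (here refl) = subst (_∈ cells Q) (sym (translate-⊖ʳ v t)) t∈Q
    P′⊑Q     t∈Q (there c∈P) = P⊑Q _ c∈P

grown-enumerates : ∀ n → IsEnumeration (FixedPolyiamonds n) (grown n)
grown-enumerates zero    Q = here (≈-sym {P = empty} {Q} (⊑⇒≈ empty Q 0ᵖ λ _ ()))
grown-enumerates (suc n) Q =
  let (P , P∈ , v , P⊑Q) = grown-⊑ Q n ℕ.≤-refl
  in Any.map (λ { refl → ≈-sym {P = P} {Q} (⊑⇒≈ P Q v P⊑Q) }) P∈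

representatives : ∀ n → List (Polyiamond n)
representatives n = deduplicate _≈?_ (grown n)

finite : ∀ n → ∃ λ t → Bijection (setoid (Fin t)) (FixedPolyiamonds n)
finite n = length (representatives n) , record
  { to        = lookup (representatives n)
  ; cong      = λ { refl → ≈-refl {P = lookup (representatives n) _} }
  ; bijective = (λ {i} {j} → lookup-injective (FixedPolyiamonds n)
                  (deduplicate-! (FixedPolyiamonds-dec n) (grown n)) i j)
              , lookup-surjective (FixedPolyiamonds n)
                  (enumerates-deduplicate⁺ (FixedPolyiamonds-dec n) (grown-enumerates n))
  }

-- The definition is an enumeration, but T-counts alone determines T n as
-- the number of polyiamonds with n cells up to translation.
T : ℕ → ℕ
T n = proj₁ (finite n)

T-counts : ∀ n → Bijection (setoid (Fin (T n))) (FixedPolyiamonds n)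
T-counts n = proj₂ (finite n)

_ : T 1 ≡ 2
_ = refl

_ : T 2 ≡ 3
_ = refl

_ : T 3 ≡ 6
_ = refl

{-# OPTIONS --safe #-}
module Submission where

open import Defs
open import Data.Nat using (ℕ; _+_; _*_; _≤_; _≥_; suc; s≤s; z≤n)
open import Data.Product using (_×_; _,_; proj₁; proj₂; ∃; ∃₂; Σ-syntax)
open import Relation.Binary.PropositionalEquality
  using (_≡_; _≢_; refl; sym; trans; cong; cong₂; subst; subst₂; isEquivalence)
open import Relation.Nullary using (¬_; Dec; yes; no; ¬?; contradiction; _×-dec_; _⊎-dec_)
open import Data.Empty using (⊥; ⊥-elim)
open import Data.Fin.Base using (Fin; zero; suc; combine; remQuot)
open import Data.Fin.Properties using (injective⇒≤; combine-remQuot)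
open import Data.Integer.Base as ℤ using (ℤ; 0ℤ; 1ℤ)
import Data.Integer.Properties as ℤ
open import Data.List.Base using (List; []; _∷_; _++_; length; map; concatMap; filter)
open import Data.List.Membership.DecPropositional _≟ᶜ_ using (_∈?_)
open import Data.List.Membership.Propositional using (_∈_; _∉_; find; lose)
open import Data.List.Membership.Propositional.Properties
  using (∈-map⁺; ∈-map⁻; ∈-concatMap⁺; ∈-++⁺ˡ; ∈-++⁺ʳ; ∈-++⁻; ∈-filter⁺; ∈-filter⁻)
open import Data.List.Properties using (length-map; length-++; map-∘; map-id; map-cong)
open import Data.List.Relation.Binary.Subset.Propositional using (_⊆_)
open import Data.List.Relation.Unary.All as All using (All; []; _∷_)
open import Data.List.Relation.Unary.All.Properties using (¬Any⇒All¬)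
open import Data.List.Relation.Unary.AllPairs using ([]; _∷_)
open import Data.List.Relation.Unary.Any using (here; there; any?)
open import Data.List.Relation.Unary.Unique.Propositional using (Unique)
import Data.List.Relation.Unary.Unique.Propositional.Properties as Unique
import Data.Nat.Properties as ℕ
open import Data.Sum.Base as Sum using (_⊎_; inj₁; inj₂)
open import Function.Base using (_∘_; flip; id)
open import Function.Bundles using (Bijection; module Equivalence)
open import Level using (0ℓ)
open import Relation.Binary.Construct.Closure.ReflexiveTransitive as Star using (Star; ε; _◅_; _◅◅_)
import Relation.Binary.Construct.Flip.EqAndOrd as Flip
open import Relation.Binary.Core using (Rel)
open import Relation.Binary.Definitions using (Transitive; Tri; tri<; tri≈; tri>)
open import Relation.Binary.Structures using (IsStrictTotalOrder)
open import Relation.Binary.Structures.Biased using (isStrictTotalOrderᶜ)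
open import Relation.Nullary.Decidable using (from-yes)

-- Order the cells row by row, from bottom to top.  If P₁ and P₂ are glued in
-- such a way that the cells of P₁ precede those of P₂, then the result
-- determines both, P₁ being its first ℓ cells.  Let ℓ , m ≥ 2.
--
-- If the top row of P₁ contains a down cell and the bottom row of P₂ an up
-- cell, then P₂ can be stacked on P₁.  In the other cases these two rows are
-- merged.  With rows read from left to right, P₂ can be appended to P₁ if P₁
-- ends with an up cell and P₂ begins with a down cell.  Up to a half turn, the
-- remaining case is that the top row of P₁ has only up cells and P₂ begins
-- with an up cell.  Here P₁ is put on the other side of P₂, and rows are read
-- from right to left; if both ends of the bottom row of P₂ are up cells, the
-- right one is first moved to the left end, where it becomes a down cell.
--
-- A result of the last kind is also a result of the other kinds only if the
-- leftmost cell of the merged row is an up cell that lies on a cell of P₁.  In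
-- that event the last cell of P₁ is moved there instead, and P₂ takes the
-- place that it leaves.
--
-- For ℓ = 1 it suffices to enlarge P₂ in two ways, as T 1 = 2: by the cell to
-- the left of its first cell, and by a cell below or to the right of its
-- bottom row.

-- Cells of the lattice and their neighbours

row abscissa : Cell → ℤ
row ((_ , y) , _) = y
abscissa ((x , _) , _) = x

orient : Cell → Orientation
orient = proj₂

Up Down : Cell → Set
Up c   = orient c ≡ up
Down c = orient c ≡ down

up≢down : ∀ {o} → o ≡ up → o ≢ down
up≢down refl ()

≢up⇒down : ∀ {o} → o ≢ up → o ≡ down
≢up⇒down {up}   o≢up = contradiction refl o≢up
≢up⇒down {down} _    = refl

≢down⇒up : ∀ {o} → o ≢ down → o ≡ up
≢down⇒up {up}   _      = refl
≢down⇒up {down} o≢down = contradiction refl o≢down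

-- Geometrically, `next` and `prev` are reached through the slanted edges, within the row, and
-- `across` through the horizontal edge, which is the lower side of an up cell and the upper side of
-- a down cell.
next prev across : Cell → Cell
next   (p , up)   = p , down
next   (p , down) = p ⊕ e₁ , up
prev   (p , up)   = p ⊕ (⊖ e₁) , down
prev   (p , down) = p , up
across (p , up)   = p ⊕ (⊖ e₂) , down
across (p , down) = p ⊕ e₂ , up

opposite : Orientation → Orientation
opposite up   = down
opposite down = up

orient-next : ∀ c → orient (next c) ≡ opposite (orient c)
orient-next (_ , up)   = refl
orient-next (_ , down) = refl

orient-prev : ∀ c → orient (prev c) ≡ opposite (orient c)
orient-prev (_ , up)   = refl
orient-prev (_ , down) = refl

orient-across : ∀ c → orient (across c) ≡ opposite (orient c)
orient-across (_ , up)   = refl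
orient-across (_ , down) = refl

⊕-cancelʳ′ : ∀ p u → (p ⊕ (⊖ u)) ⊕ u ≡ p
⊕-cancelʳ′ p u = trans (⊕-assoc p (⊖ u) u)
  (trans (cong (p ⊕_) (⊕-inverseˡ u)) (trans (⊕-comm p 0ᵖ) (⊕-identityˡ p)))

next-prev : ∀ c → next (prev c) ≡ c
next-prev (p , up)   = cong (_, up) (⊕-cancelʳ′ p e₁)
next-prev (p , down) = refl

prev-next : ∀ c → prev (next c) ≡ c
prev-next (p , up)   = refl
prev-next (p , down) = cong (_, down) (⊕-cancelʳ p e₁)

across-across : ∀ c → across (across c) ≡ c
across-across (p , up)   = cong (_, up) (⊕-cancelʳ′ p e₂)
across-across (p , down) = cong (_, down) (⊕-cancelʳ p e₂)

-- `Adjacent` recast as an inductive family, so that the three edges of a cell can be treated by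
-- pattern matching; the two notions are shown to imply each other.
data Neighbour (c : Cell) : Cell → Set where
  right   : Neighbour c (next c)
  left    : Neighbour c (prev c)
  outward : Neighbour c (across c)

translate-next : ∀ v c → translate v (next c) ≡ next (translate v c)
translate-next v (p , up)   = refl
translate-next v (p , down) = cong (_, up) (sym (⊕-assoc v p e₁))

translate-prev : ∀ v c → translate v (prev c) ≡ prev (translate v c)
translate-prev v (p , up)   = cong (_, down) (sym (⊕-assoc v p (⊖ e₁)))
translate-prev v (p , down) = refl

translate-across : ∀ v c → translate v (across c) ≡ across (translate v c)
translate-across v (p , up)   = cong (_, down) (sym (⊕-assoc v p (⊖ e₂)))
translate-across v (p , down) = cong (_, up) (sym (⊕-assoc v p e₂))

translate-neighbour : ∀ v {c d} → Neighbour c d → Neighbour (translate v c) (translate v d)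
translate-neighbour v {c} right   = subst (Neighbour _) (sym (translate-next v c)) right
translate-neighbour v {c} left    = subst (Neighbour _) (sym (translate-prev v c)) left
translate-neighbour v {c} outward = subst (Neighbour _) (sym (translate-across v c)) outward

at-origin : ∀ p o → translate p (0ᵖ , o) ≡ (p , o)
at-origin p o = cong (_, o) (trans (⊕-comm p 0ᵖ) (⊕-identityˡ p))

-- Two cells that share a corner are at bounded distance, so that adjacency to
-- a cell at the origin is settled by evaluation.
nearby : Orientation → List Cell
nearby o = concatMap around (corners (0ᵖ , o))

neighbour? : ∀ c d → Dec (Neighbour c d)
neighbour? c d with d ≟ᶜ next c | d ≟ᶜ prev c | d ≟ᶜ across c
... | yes refl | _ | _ = yes right
... | _ | yes refl | _ = yes left
... | _ | _ | yes refl = yes outward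
... | no ¬r | no ¬l | no ¬o = no λ { right → ¬r refl ; left → ¬l refl ; outward → ¬o refl }

adjacent⇒neighbour₀ : ∀ o {d} → Adjacent (0ᵖ , o) d → Neighbour (0ᵖ , o) d
adjacent⇒neighbour₀ o {d} adj@(_ , u , _ , _ , (u∈c , _) , (u∈d , _)) =
  dec-elim (All.lookup (checked o)
    (∈-concatMap⁺ around {xs = corners (0ᵖ , o)} (lose u∈c (∈-around d u∈d)))) adj
  where
  Ok : Orientation → Cell → Set
  Ok o d = ¬ Adjacent (0ᵖ , o) d ⊎ Neighbour (0ᵖ , o) d

  ok? : ∀ o d → Dec (Ok o d)
  ok? o d = ¬? (adjacent? (0ᵖ , o) d) ⊎-dec neighbour? (0ᵖ , o) d

  checked : ∀ o → All (Ok o) (nearby o)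
  checked up   = from-yes (All.all? (ok? up) (nearby up))
  checked down = from-yes (All.all? (ok? down) (nearby down))

  dec-elim : ∀ {o d} → Ok o d → Adjacent (0ᵖ , o) d → Neighbour (0ᵖ , o) d
  dec-elim (inj₁ ¬adj) adj = contradiction adj ¬adj
  dec-elim (inj₂ n)    _   = n

-- Both notions are invariant under translation, so the first cell may be moved to the origin, where
-- the finite check applies.
adjacent⇒neighbour : ∀ {c d} → Adjacent c d → Neighbour c d
adjacent⇒neighbour {p , o} {d} adj =
  subst₂ Neighbour (at-origin p o) (translate-⊖ʳ p d)
    (translate-neighbour p (adjacent⇒neighbour₀ o
      (subst (λ c → Adjacent c (translate (⊖ p) d)) (cong (_, o) (⊕-inverseˡ p))
        (adjacent-translate (⊖ p) adj))))

neighbour⇒adjacent : ∀ {c d} → Neighbour c d → Adjacent c d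
neighbour⇒adjacent {p , o} n = subst (λ c → Adjacent c _) (at-origin p o) (moved n)
  where
  around₀ : Orientation → List Cell
  around₀ o = next (0ᵖ , o) ∷ prev (0ᵖ , o) ∷ across (0ᵖ , o) ∷ []

  origin : ∀ o → All (Adjacent (0ᵖ , o)) (around₀ o)
  origin up   = from-yes (All.all? (adjacent? (0ᵖ , up)) (around₀ up))
  origin down = from-yes (All.all? (adjacent? (0ᵖ , down)) (around₀ down))

  moved : ∀ {d} → Neighbour (p , o) d → Adjacent (translate p (0ᵖ , o)) d
  moved right   = subst (Adjacent _) (trans (translate-next p _) (cong next (at-origin p o)))
                    (adjacent-translate p (All.lookup (origin o) (here refl)))
  moved left    = subst (Adjacent _) (trans (translate-prev p _) (cong prev (at-origin p o)))
                    (adjacent-translate p (All.lookup (origin o) (there (here refl))))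
  moved outward = subst (Adjacent _) (trans (translate-across p _) (cong across (at-origin p o)))
                    (adjacent-translate p (All.lookup (origin o) (there (there (here refl)))))

-- Two reading orders

infix 4 _◁_ _<ᶻ_ _<ᵐ_ _≋_

-- Left to right, meant for cells of a common row: rows are not compared here. Of the two halves of
-- a rhombus the up cell lies to the left.
data _◁_ (c d : Cell) : Set where
  apart  : abscissa c ℤ.< abscissa d → c ◁ d
  halves : abscissa c ≡ abscissa d → Up c → Down d → c ◁ d

-- The order within rows is a parameter, so that facts about rows alone are proved once and can
-- relate extreme cells of different reading orders.
data Swept (_◃_ : Rel Cell 0ℓ) (c d : Cell) : Set where
  lower : row c ℤ.< row d → Swept _◃_ c d
  along : row c ≡ row d → c ◃ d → Swept _◃_ c d

-- Rows are read from bottom to top in both orders, from left to right in <ᶻ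
-- and from right to left in <ᵐ.
_<ᶻ_ _<ᵐ_ : Rel Cell 0ℓ
_<ᶻ_ = Swept _◁_
_<ᵐ_ = Swept (flip _◁_)

◁-irrefl : ∀ {c} → ¬ c ◁ c
◁-irrefl (apart x<x)     = ℤ.<-irrefl refl x<x
◁-irrefl (halves _ u d) = up≢down u d

◁-trans : Transitive _◁_
◁-trans (apart p)        (apart q)        = apart (ℤ.<-trans p q)
◁-trans (apart p)        (halves q _ _)   = apart (subst (_ ℤ.<_) q p)
◁-trans (halves p _ _)   (apart q)        = apart (subst (ℤ._< _) (sym p) q)
◁-trans (halves p u d)   (halves q u′ d′) = contradiction d (up≢down u′)

◁-connex : ∀ c d → row c ≡ row d → c ≡ d ⊎ c ◁ d ⊎ d ◁ c
◁-connex ((x , y) , o) ((x′ , _) , o′) refl with ℤ.<-cmp x x′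
... | tri< x<x′ _ _ = inj₂ (inj₁ (apart x<x′))
... | tri> _ _ x′<x = inj₂ (inj₂ (apart x′<x))
◁-connex (_ , up)   (_ , up)   refl | tri≈ _ refl _ = inj₁ refl
◁-connex (_ , up)   (_ , down) refl | tri≈ _ refl _ = inj₂ (inj₁ (halves refl refl refl))
◁-connex (_ , down) (_ , up)   refl | tri≈ _ refl _ = inj₂ (inj₂ (halves refl refl refl))
◁-connex (_ , down) (_ , down) refl | tri≈ _ refl _ = inj₁ refl

module _ {_◃_ : Rel Cell 0ℓ} where

  swept-row : ∀ {c d} → Swept _◃_ c d → row c ℤ.≤ row d
  swept-row (lower p)   = ℤ.<⇒≤ p
  swept-row (along p _) = ℤ.≤-reflexive p

  swept-along : ∀ {c d} → row c ≡ row d → Swept _◃_ c d → c ◃ d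
  swept-along eq (lower p)   = contradiction p (ℤ.<-irrefl eq)
  swept-along eq (along _ p) = p

  swept-isStrictTotalOrder : (∀ {c} → ¬ c ◃ c) → Transitive _◃_ →
    (∀ c d → row c ≡ row d → c ≡ d ⊎ c ◃ d ⊎ d ◃ c) → IsStrictTotalOrder _≡_ (Swept _◃_)
  swept-isStrictTotalOrder irr tr connex = isStrictTotalOrderᶜ record
    { isEquivalence = isEquivalence ; trans = trans′ ; compare = cmp }
    where
    irr′ : ∀ {c} → ¬ Swept _◃_ c c
    irr′ (lower p)   = ℤ.<-irrefl refl p
    irr′ (along _ p) = irr p

    trans′ : Transitive (Swept _◃_)
    trans′ (lower p)    (lower q)    = lower (ℤ.<-trans p q)
    trans′ (lower p)    (along q _)  = lower (subst (_ ℤ.<_) q p)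
    trans′ (along p _)  (lower q)    = lower (subst (ℤ._< _) (sym p) q)
    trans′ (along p p′) (along q q′) = along (trans p q) (tr p′ q′)

    below : ∀ {c d} → Swept _◃_ c d → c ≢ d × ¬ Swept _◃_ d c
    below p = (λ { refl → irr′ p }) , λ q → irr′ (trans′ p q)

    cmp : ∀ c d → Tri (Swept _◃_ c d) (c ≡ d) (Swept _◃_ d c)
    cmp c d with ℤ.<-cmp (row c) (row d)
    ... | tri< p _ _ = tri< (lower p) (proj₁ (below (lower p))) (proj₂ (below (lower p)))
    ... | tri> _ _ p = tri> (proj₂ (below (lower p))) (proj₁ (below (lower p)) ∘ sym) (lower p)
    ... | tri≈ _ p _ with connex c d p
    ...   | inj₁ refl     = tri≈ irr′ refl irr′
    ...   | inj₂ (inj₁ q) = tri< (along p q) (proj₁ (below (along p q))) (proj₂ (below (along p q)))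
    ...   | inj₂ (inj₂ q) = let r = along (sym p) q in tri> (proj₂ (below r)) (proj₁ (below r) ∘ sym) r

<ᶻ-isStrictTotalOrder : IsStrictTotalOrder _≡_ _<ᶻ_
<ᶻ-isStrictTotalOrder = swept-isStrictTotalOrder ◁-irrefl ◁-trans ◁-connex

<ᵐ-isStrictTotalOrder : IsStrictTotalOrder _≡_ _<ᵐ_
<ᵐ-isStrictTotalOrder = swept-isStrictTotalOrder ◁-irrefl (flip ◁-trans)
  (λ c d eq → Sum.map₂ Sum.swap (◁-connex c d eq))

module Z = IsStrictTotalOrder <ᶻ-isStrictTotalOrder
module M = IsStrictTotalOrder <ᵐ-isStrictTotalOrder

i<i+1 : ∀ i → i ℤ.< i ℤ.+ 1ℤ
i<i+1 i = subst (ℤ._< i ℤ.+ 1ℤ) (ℤ.+-identityʳ i) (ℤ.+-monoʳ-< i (ℤ.+<+ (s≤s z≤n)))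

◁-next : ∀ c → c ◁ next c
◁-next (_ , up)   = halves refl refl refl
◁-next ((x , _) , down) = apart (i<i+1 x)

row-next : ∀ c → row (next c) ≡ row c
row-next (_ , up)   = refl
row-next (_ , down) = ℤ.+-identityʳ _

row-prev : ∀ c → row (prev c) ≡ row c
row-prev c = trans (sym (row-next (prev c))) (cong row (next-prev c))

prev-◁ : ∀ c → prev c ◁ c
prev-◁ c = subst (prev c ◁_) (next-prev c) (◁-next (prev c))

row-across-down : ∀ {c} → Down c → row c ℤ.< row (across c)
row-across-down {(_ , y) , _} refl = i<i+1 y

row-across-up : ∀ {c} → Up c → row (across c) ℤ.< row c
row-across-up {c@((x , y) , _)} refl =
  subst (row (across c) ℤ.<_) (cong row (across-across c)) (row-across-down {across c} refl)

-- Sets of cells: extreme cells and cuts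

_≋_ : Rel (List Cell) 0ℓ
xs ≋ ys = xs ⊆ ys × ys ⊆ xs

≋-sym : ∀ {xs ys} → xs ≋ ys → ys ≋ xs
≋-sym (f , g) = g , f

≋-trans : ∀ {xs ys zs} → xs ≋ ys → ys ≋ zs → xs ≋ zs
≋-trans (f , g) (f′ , g′) = f′ ∘ f , g ∘ g′

-- The relation is arbitrary because the record also serves for the non-strict `Above`, where
-- several cells may qualify.
record Least (_≺_ : Rel Cell 0ℓ) (xs : List Cell) (b : Cell) : Set where
  constructor least
  field
    member : b ∈ xs
    bound  : ∀ {x} → x ∈ xs → b ≡ x ⊎ b ≺ x

open Least public

Greatest : Rel Cell 0ℓ → List Cell → Cell → Set
Greatest _≺_ = Least (flip _≺_)

module _ {_≺_ : Rel Cell 0ℓ} (O : IsStrictTotalOrder _≡_ _≺_) where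

  private module O = IsStrictTotalOrder O

  least-exists : ∀ {x xs} → x ∈ xs → ∃ (Least _≺_ xs)
  least-exists {xs = y ∷ []} _ = y , least (here refl) λ { (here refl) → inj₁ refl }
  least-exists {xs = y ∷ zs@(_ ∷ _)} _ with least-exists {xs = zs} (here refl)
  ... | b , least b∈ b≤ with O.compare y b
  ...   | tri< y<b _ _ = y , least (here refl) λ
          { (here refl) → inj₁ refl
          ; (there x∈)  → inj₂ (Sum.[ (λ { refl → y<b }) , O.trans y<b ] (b≤ x∈)) }
  ...   | tri≈ _ refl _ = y , least (here refl) λ
          { (here refl) → inj₁ refl
          ; (there x∈)  → b≤ x∈ }
  ...   | tri> _ _ b<y = b , least (there b∈) λ
          { (here refl) → inj₂ b<y
          ; (there x∈)  → b≤ x∈ }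

  least-unique : ∀ {xs ys b c} → Least _≺_ xs b → Least _≺_ ys c → xs ≋ ys → b ≡ c
  least-unique (least b∈ b≤) (least c∈ c≤) (f , g) with b≤ (g c∈) | c≤ (f b∈)
  ... | inj₁ refl | _         = refl
  ... | inj₂ _    | inj₁ refl = refl
  ... | inj₂ b<c  | inj₂ c<b  = contradiction c<b (O.asym b<c)

  ≼-≺-trans : ∀ {b c d} → b ≡ c ⊎ b ≺ c → c ≺ d → b ≺ d
  ≼-≺-trans (inj₁ refl) q = q
  ≼-≺-trans (inj₂ p)    q = O.trans p q

  ≺-≼-trans : ∀ {b c d} → b ≺ c → c ≡ d ⊎ c ≺ d → b ≺ d
  ≺-≼-trans p (inj₁ refl) = p
  ≺-≼-trans p (inj₂ q)    = O.trans p q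

record Cut (_≺_ : Rel Cell 0ℓ) (ℓ m : ℕ) (L R : List Cell) : Set where
  field
    uniqueˡ : Unique L
    uniqueʳ : Unique R
    sizeˡ   : length L ≡ ℓ
    sizeʳ   : length R ≡ m
    before  : ∀ {x y} → x ∈ L → y ∈ R → x ≺ y

open Cut public

module _ {_≺_ : Rel Cell 0ℓ} (O : IsStrictTotalOrder _≡_ _≺_) where

  private module O = IsStrictTotalOrder O

  cut-disjoint : ∀ {ℓ m L R x} → Cut _≺_ ℓ m L R → x ∈ L → x ∉ R
  cut-disjoint K x∈L x∈R = O.irrefl refl (before K x∈L x∈R)

  -- A cell `x` of `L` outside `L′` lies in `R′`, hence after all of `L′`. Then no cell of `L′` can
  -- lie in `R`, so `L` contains `L′` and `x`, which is one cell too many.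
  cut-⊆ˡ : ∀ {ℓ m L R L′ R′} → Cut _≺_ ℓ m L R → Cut _≺_ ℓ m L′ R′ → L ++ R ≋ L′ ++ R′ → L ⊆ L′
  cut-⊆ˡ {L = L} {R} {L′} {R′} K K′ (f , g) {x} x∈L with ∈-++⁻ L′ (f (∈-++⁺ˡ x∈L))
  ... | inj₁ x∈L′ = x∈L′
  ... | inj₂ x∈R′ = contradiction
    (subst₂ _≤_ (cong suc (sizeˡ K′)) (sizeˡ K)
      (unique-⊆⇒length≤ {x ∷ L′} {L}
        (¬Any⇒All¬ _ (λ x∈L′ → cut-disjoint K′ x∈L′ x∈R′) ∷ uniqueˡ K′)
        λ { (here refl) → x∈L ; (there y∈) → L′⊆L y∈ }))
    ℕ.1+n≰n
    where
    L′⊆L : L′ ⊆ L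
    L′⊆L y∈L′ with ∈-++⁻ L (g (∈-++⁺ˡ y∈L′))
    ... | inj₁ y∈L = y∈L
    ... | inj₂ y∈R = contradiction (before K′ y∈L′ x∈R′) (O.asym (before K x∈L y∈R))

  cut-unique : ∀ {ℓ m L R L′ R′} → Cut _≺_ ℓ m L R → Cut _≺_ ℓ m L′ R′ →
               L ++ R ≋ L′ ++ R′ → L ≋ L′ × R ≋ R′
  cut-unique K K′ eq = (cut-⊆ˡ K K′ eq , cut-⊆ˡ K′ K (≋-sym eq)) , (rest K K′ eq , rest K′ K (≋-sym eq))
    where
    rest : ∀ {ℓ m L R L′ R′} → Cut _≺_ ℓ m L R → Cut _≺_ ℓ m L′ R′ → L ++ R ≋ L′ ++ R′ → R ⊆ R′
    rest {L = L} {L′ = L′} K K′ eq x∈R with ∈-++⁻ L′ (proj₁ eq (∈-++⁺ʳ L x∈R))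
    ... | inj₂ x∈R′ = x∈R′
    ... | inj₁ x∈L′ = contradiction x∈R (cut-disjoint K (cut-⊆ˡ K′ K (≋-sym eq) x∈L′))

-- Moving a single cell

replace : Cell → Cell → List Cell → List Cell
replace c d xs = d ∷ filter (λ x → ¬? (x ≟ᶜ c)) xs

module _ {c d : Cell} {xs : List Cell} where

  ∈-replace⁻ : ∀ {x} → x ∈ replace c d xs → x ≡ d ⊎ (x ∈ xs × x ≢ c)
  ∈-replace⁻ (here refl) = inj₁ refl
  ∈-replace⁻ (there x∈)  = inj₂ (∈-filter⁻ (λ x → ¬? (x ≟ᶜ c)) x∈)

  ∈-replace⁺ : ∀ {x} → x ∈ xs → x ≢ c → x ∈ replace c d xs
  ∈-replace⁺ x∈ x≢c = there (∈-filter⁺ (λ x → ¬? (x ≟ᶜ c)) x∈ x≢c)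

  replace-unique : Unique xs → d ∉ xs → Unique (replace c d xs)
  replace-unique xs! d∉ = ¬Any⇒All¬ _ (λ d∈ → d∉ (proj₁ (∈-filter⁻ (λ x → ¬? (x ≟ᶜ c)) {xs = xs} d∈)))
    ∷ Unique.filter⁺ (λ x → ¬? (x ≟ᶜ c)) xs!

  replace-length : Unique xs → c ∈ xs → length (replace c d xs) ≡ length xs
  replace-length xs! c∈ = ℕ.≤-antisym
    (unique-⊆⇒length≤ {c ∷ rest} {xs} c∷rest!
      λ { (here refl) → c∈ ; (there x∈) → proj₁ (∈-filter⁻ (λ x → ¬? (x ≟ᶜ c)) x∈) })
    (unique-⊆⇒length≤ {xs} {c ∷ rest} xs! λ {x} x∈ → split x x∈)
    where
    rest = filter (λ x → ¬? (x ≟ᶜ c)) xs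

    c∷rest! : Unique (c ∷ rest)
    c∷rest! = ¬Any⇒All¬ _ (λ c∈ → proj₂ (∈-filter⁻ (λ x → ¬? (x ≟ᶜ c)) {xs = xs} c∈) refl)
      ∷ Unique.filter⁺ (λ x → ¬? (x ≟ᶜ c)) xs!

    split : ∀ x → x ∈ xs → x ∈ c ∷ rest
    split x x∈ with x ≟ᶜ c
    ... | yes refl = here refl
    ... | no  x≢c  = there (∈-filter⁺ (λ x → ¬? (x ≟ᶜ c)) x∈ x≢c)

  -- This is what lets a polyiamond be recovered after one of its cells has been moved.
  replace-undo : c ∈ xs → d ∉ xs → replace d c (replace c d xs) ≋ xs
  replace-undo c∈ d∉ = to , from
    where
    to : replace d c (replace c d xs) ⊆ xs
    to (here refl) = c∈
    to (there x∈) with ∈-filter⁻ (λ x → ¬? (x ≟ᶜ d)) {xs = replace c d xs} x∈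
    ... | x∈′ , x≢d with ∈-replace⁻ x∈′
    ...   | inj₁ x≡d       = contradiction x≡d x≢d
    ...   | inj₂ (x∈xs , _) = x∈xs

    from : xs ⊆ replace d c (replace c d xs)
    from {x} x∈ with x ≟ᶜ c
    ... | yes refl = here refl
    ... | no  x≢c  = there (∈-filter⁺ (λ x → ¬? (x ≟ᶜ d)) (∈-replace⁺ x∈ x≢c) λ { refl → d∉ x∈ })

replace-⊆ : ∀ {c d xs ys} → xs ⊆ ys → replace c d xs ⊆ replace c d ys
replace-⊆ f (here refl) = here refl
replace-⊆ {c} {xs = xs} f (there x∈) =
  let (x∈xs , x≢c) = ∈-filter⁻ (λ x → ¬? (x ≟ᶜ c)) {xs = xs} x∈ in ∈-replace⁺ (f x∈xs) x≢c

replace-cong : ∀ {c d xs ys} → xs ≋ ys → replace c d xs ≋ replace c d ys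
replace-cong (f , g) = replace-⊆ f , replace-⊆ g

-- Half turns

-- On the plane this is the half turn that sends `x` to `w ⊕ e₁ ⊕ e₂ ⊕ (⊖ x)`: it carries the
-- corners of `(p , up)` to those of `(w ⊕ (⊖ p) , down)`.
turn : Point → Cell → Cell
turn w (p , o) = w ⊕ (⊖ p) , opposite o

opposite-opposite : ∀ o → opposite (opposite o) ≡ o
opposite-opposite up   = refl
opposite-opposite down = refl

⊖-⊕ : ∀ p q → ⊖ (p ⊕ q) ≡ (⊖ p) ⊕ (⊖ q)
⊖-⊕ (x , y) (x′ , y′) = cong₂ _,_ (ℤ.neg-distrib-+ x x′) (ℤ.neg-distrib-+ y y′)

⊖-⊖ : ∀ p → ⊖ (⊖ p) ≡ p
⊖-⊖ (x , y) = cong₂ _,_ (ℤ.neg-involutive x) (ℤ.neg-involutive y)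

-- Translations are products of two half turns, so that invariance under half
-- turns is all that has to be shown of Outcome below.
turn-turn : ∀ v w c → turn v (turn w c) ≡ translate (v ⊕ (⊖ w)) c
turn-turn v w (p , o) = cong₂ _,_
  (trans (cong (v ⊕_) (trans (⊖-⊕ w (⊖ p)) (cong ((⊖ w) ⊕_) (⊖-⊖ p)))) (sym (⊕-assoc v (⊖ w) p)))
  (opposite-opposite o)

turn-involutive : ∀ w c → turn w (turn w c) ≡ c
turn-involutive w c = trans (turn-turn w w c)
  (trans (cong (λ u → translate u c) (⊕-inverseʳ w)) (translate-0ᵖ c))

turn-injective : ∀ w {c d} → turn w c ≡ turn w d → c ≡ d
turn-injective w {c} {d} eq =
  trans (sym (turn-involutive w c)) (trans (cong (turn w) eq) (turn-involutive w d))

turn-translate : ∀ w u c → turn w (translate u c) ≡ translate (w ⊕ (⊖ u)) (turn 0ᵖ c)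
turn-translate w u (p , o) = cong (_, opposite o)
  (trans (cong (w ⊕_) (⊖-⊕ u p)) (trans (sym (⊕-assoc w (⊖ u) (⊖ p)))
    (cong ((w ⊕ (⊖ u)) ⊕_) (sym (⊕-identityˡ (⊖ p))))))

turn-shift : ∀ w p e → w ⊕ (⊖ (p ⊕ e)) ≡ (w ⊕ (⊖ p)) ⊕ (⊖ e)
turn-shift w p e = trans (cong (w ⊕_) (⊖-⊕ p e)) (sym (⊕-assoc w (⊖ p) (⊖ e)))

turn-shift⁻ : ∀ w p e → w ⊕ (⊖ (p ⊕ (⊖ e))) ≡ (w ⊕ (⊖ p)) ⊕ e
turn-shift⁻ w p e = trans (turn-shift w p (⊖ e)) (cong ((w ⊕ (⊖ p)) ⊕_) (⊖-⊖ e))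

turn-next : ∀ w c → turn w (next c) ≡ prev (turn w c)
turn-next w (p , up)   = refl
turn-next w (p , down) = cong (_, down) (turn-shift w p e₁)

turn-prev : ∀ w c → turn w (prev c) ≡ next (turn w c)
turn-prev w (p , up)   = cong (_, up) (turn-shift⁻ w p e₁)
turn-prev w (p , down) = refl

turn-across : ∀ w c → turn w (across c) ≡ across (turn w c)
turn-across w (p , up)   = cong (_, up) (turn-shift⁻ w p e₂)
turn-across w (p , down) = cong (_, down) (turn-shift w p e₂)

turn-neighbour : ∀ w {c d} → Neighbour c d → Neighbour (turn w c) (turn w d)
turn-neighbour w {c} right   = subst (Neighbour _) (sym (turn-next w c)) left
turn-neighbour w {c} left    = subst (Neighbour _) (sym (turn-prev w c)) right
turn-neighbour w {c} outward = subst (Neighbour _) (sym (turn-across w c)) outward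

turn-row-< : ∀ w {c d} → row c ℤ.< row d → row (turn w d) ℤ.< row (turn w c)
turn-row-< w p = ℤ.+-monoʳ-< (proj₂ w) (ℤ.neg-mono-< p)

turn-row-≡ : ∀ w {c d} → row c ≡ row d → row (turn w d) ≡ row (turn w c)
turn-row-≡ w p = cong (λ y → proj₂ w ℤ.+ ℤ.- y) (sym p)

opposite-up : ∀ {o} → o ≡ up → opposite o ≡ down
opposite-up refl = refl

opposite-down : ∀ {o} → o ≡ down → opposite o ≡ up
opposite-down refl = refl

opposite-up⁻ : ∀ {o} → opposite o ≡ up → o ≡ down
opposite-up⁻ {down} _ = refl

opposite-down⁻ : ∀ {o} → opposite o ≡ down → o ≡ up
opposite-down⁻ {up} _ = refl

turn-◁ : ∀ w {c d} → c ◁ d → turn w d ◁ turn w c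
turn-◁ w (apart p)      = apart (ℤ.+-monoʳ-< (proj₁ w) (ℤ.neg-mono-< p))
turn-◁ w (halves p u d) = halves (cong (λ x → proj₁ w ℤ.+ ℤ.- x) (sym p)) (opposite-down d) (opposite-up u)

turn-<ᶻ : ∀ w {c d} → c <ᶻ d → turn w d <ᶻ turn w c
turn-<ᶻ w {c} {d} (lower p)   = lower (turn-row-< w {c} {d} p)
turn-<ᶻ w {c} {d} (along p q) = along (turn-row-≡ w {c} {d} p) (turn-◁ w q)

turn-<ᵐ : ∀ w {c d} → c <ᵐ d → turn w d <ᵐ turn w c
turn-<ᵐ w {c} {d} (lower p)   = lower (turn-row-< w {c} {d} p)
turn-<ᵐ w {c} {d} (along p q) = along (turn-row-≡ w {c} {d} p) (turn-◁ w q)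

map-⊆ : ∀ (f : Cell → Cell) {xs ys} → xs ⊆ ys → map f xs ⊆ map f ys
map-⊆ f {xs} xs⊆ys y∈ =
  let (x , x∈ , eq) = ∈-map⁻ f {xs = xs} y∈ in subst (_∈ _) (sym eq) (∈-map⁺ f (xs⊆ys x∈))

map-≋ : ∀ (f : Cell → Cell) {xs ys} → xs ≋ ys → map f xs ≋ map f ys
map-≋ f (p , q) = map-⊆ f p , map-⊆ f q

∈-turn⁻ : ∀ w {c xs} → turn w c ∈ map (turn w) xs → c ∈ xs
∈-turn⁻ w {xs = xs} c∈ =
  let (x , x∈ , eq) = ∈-map⁻ (turn w) {xs = xs} c∈ in subst (_∈ xs) (sym (turn-injective w eq)) x∈

least-map : ∀ {_≺_ _≺′_ : Rel Cell 0ℓ} (f : Cell → Cell) → (∀ {c d} → c ≺ d → f c ≺′ f d) →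
            ∀ {xs b} → Least _≺_ xs b → Least _≺′_ (map f xs) (f b)
least-map {_≺′_ = _≺′_} f mono {xs} {b} (least b∈ b≤) = least (∈-map⁺ f b∈) λ x∈ →
  let (_ , y∈ , eq) = ∈-map⁻ f {xs = xs} x∈
  in Sum.map (λ { refl → sym eq }) (λ b<y → subst (f b ≺′_) (sym eq) (mono b<y)) (b≤ y∈)

-- Outcomes of a gluing and their invariance under half turns

Placed : List Cell → List Cell → Set
Placed P S = ∃ λ u → map (translate u) P ≋ S

placed-≋ : ∀ {P S S′} → Placed P S → S ≋ S′ → Placed P S′
placed-≋ (u , eq) eq′ = u , ≋-trans eq eq′

placed-turn : ∀ w {P S} → Placed P S → Placed (map (turn 0ᵖ) P) (map (turn w) S)
placed-turn w {P} (u , eq) = w ⊕ (⊖ u) ,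
  ≋-trans (≡⇒≋ (trans (sym (map-∘ P)) (trans (map-cong (λ c → sym (turn-translate w u c)) P) (map-∘ P))))
          (map-≋ (turn w) eq)
  where
  ≡⇒≋ : ∀ {xs ys : List Cell} → xs ≡ ys → xs ≋ ys
  ≡⇒≋ refl = id , id

placed-≈ : ∀ {n} {P P′ : Polyiamond n} {S} → Placed (cells P) S → Placed (cells P′) S → P ≈ P′
placed-≈ {P = P} {P′} (u , eq) (u′ , eq′) = ⊑⇒≈ P P′ ((⊖ u′) ⊕ u) λ c c∈P →
  let (d , d∈P′ , e) = ∈-map⁻ (translate u′) (proj₂ eq′ (proj₁ eq (∈-map⁺ (translate u) c∈P)))
  in subst (_∈ cells P′)
       (trans (sym (translate-⊖ˡ u′ d))
         (trans (cong (translate (⊖ u′)) (sym e)) (sym (translate-⊕ (⊖ u′) u c))))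
       d∈P′

-- The parts meet at the top of `L` and the bottom of `R`, so only the ends of these two rows
-- matter. As `<ᵐ` reads from right to left, its greatest cell is a left end and its least cell a
-- right end.
record Corners (L R : List Cell) (topLeft topRight bottomLeft bottomRight : Cell) : Set where
  field
    isTopLeft     : Greatest _<ᵐ_ L topLeft
    isTopRight    : Greatest _<ᶻ_ L topRight
    isBottomLeft  : Least _<ᶻ_ R bottomLeft
    isBottomRight : Least _<ᵐ_ R bottomRight

open Corners public

-- How the two polyiamonds are recovered from the parts L and R of a result.
-- The corners c , a are the ends of the top row of L and b , d those of the
-- bottom row of R; the conditions on them tell the constructors apart.
data SourceZ (L R : List Cell) (c a b d : Cell) : List Cell → List Cell → Set where
  asIs  : row a ℤ.< row b ⊎ (Up a × Down b) → SourceZ L R c a b d L R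
  swapˡ : row a ≡ row b → Up a → Up b → SourceZ L R c a b d (replace c b L) R
  swapʳ : row a ≡ row b → Down a → Down b → SourceZ L R c a b d L (replace d a R)

-- `asIs` with two up cells comes from `prepend`, and `swapʳ` from `overlay`; the rest are their
-- half turns. When `a` is up and `b` is down, it is the presence of `prev a` and `next b` that
-- tells which polyiamond had a cell moved.
data SourceM (L R : List Cell) (c a b d : Cell) : List Cell → List Cell → Set where
  asIs  : orient a ≡ orient b → SourceM L R c a b d L R
  swapˡ : Up a → Down b → prev a ∈ L → next b ∉ R → SourceM L R c a b d (replace a d L) R
  swapʳ : Up a → Down b → prev a ∉ L → next b ∈ R → SourceM L R c a b d L (replace b c R)

-- No set of cells has both a cut with WitnessZ and one with WitnessM (mixed-⊥).
WitnessZ WitnessM : (L R : List Cell) (c a b d : Cell) → Set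
WitnessZ L R c a b d =
  row a ℤ.< row b ⊎ (row a ≡ row b × ((Up c × across c ∈ L) ⊎ (Down d × across d ∈ R)))
WitnessM L R c a b d =
  row a ≡ row b × ¬ (Up b × across b ∈ L) × ¬ (Down a × across a ∈ R)

-- A certificate, in place of an inverse map, that `Q` arose from `P₁` and `P₂`. It speaks of sets
-- of cells up to translation, so that it can be carried along `≈`.
data Outcome (ℓ m : ℕ) (P₁ P₂ Q : List Cell) : Set where
  zigzag : ∀ {L R c a b d S₁ S₂} → Cut _<ᶻ_ ℓ m L R → L ++ R ≋ Q → Corners L R c a b d →
           WitnessZ L R c a b d → SourceZ L R c a b d S₁ S₂ →
           Placed P₁ S₁ → Placed P₂ S₂ → Outcome ℓ m P₁ P₂ Q
  mirror : ∀ {L R c a b d S₁ S₂} → Cut _<ᵐ_ ℓ m L R → L ++ R ≋ Q → Corners L R c a b d →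
           WitnessM L R c a b d → SourceM L R c a b d S₁ S₂ →
           Placed P₁ S₁ → Placed P₂ S₂ → Outcome ℓ m P₁ P₂ Q

outcome-≋ : ∀ {ℓ m P₁ P₂ Q Q′} → Outcome ℓ m P₁ P₂ Q → Q ≋ Q′ → Outcome ℓ m P₁ P₂ Q′
outcome-≋ (zigzag K eq C W S p₁ p₂) eq′ = zigzag K (≋-trans eq eq′) C W S p₁ p₂
outcome-≋ (mirror K eq C W S p₁ p₂) eq′ = mirror K (≋-trans eq eq′) C W S p₁ p₂

module _ (w : Point) where

  private
    t = turn w
    ts = map (turn w)

  cut-turn : ∀ {_≺_ : Rel Cell 0ℓ} → (∀ {c d} → c ≺ d → t d ≺ t c) →
             ∀ {ℓ m L R} → Cut _≺_ ℓ m L R → Cut _≺_ m ℓ (ts R) (ts L)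
  cut-turn {_≺_} mono {L = L} {R} K = record
    { uniqueˡ = Unique.map⁺ (turn-injective w) (uniqueʳ K)
    ; uniqueʳ = Unique.map⁺ (turn-injective w) (uniqueˡ K)
    ; sizeˡ   = trans (length-map t R) (sizeʳ K)
    ; sizeʳ   = trans (length-map t L) (sizeˡ K)
    ; before  = λ x∈ y∈ → let (x , x∈R , e) = ∈-map⁻ t {xs = R} x∈ ; (y , y∈L , e′) = ∈-map⁻ t {xs = L} y∈
                          in subst₂ _≺_ (sym e) (sym e′) (mono (before K y∈L x∈R))
    }

  ++-turn : ∀ L R {Q} → L ++ R ≋ Q → ts R ++ ts L ≋ ts Q
  ++-turn L R {Q} (f , g) = to , from
    where
    to : ts R ++ ts L ⊆ ts Q
    to x∈ with ∈-++⁻ (ts R) x∈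
    ... | inj₁ x∈R = map-⊆ t (f ∘ ∈-++⁺ʳ L) x∈R
    ... | inj₂ x∈L = map-⊆ t (f ∘ ∈-++⁺ˡ) x∈L

    from : ts Q ⊆ ts R ++ ts L
    from x∈ with ∈-map⁻ t {xs = Q} x∈
    ... | x , x∈Q , refl with ∈-++⁻ L (g x∈Q)
    ...   | inj₁ x∈L = ∈-++⁺ʳ (ts R) (∈-map⁺ t x∈L)
    ...   | inj₂ x∈R = ∈-++⁺ˡ (∈-map⁺ t x∈R)

  corners-turn : ∀ {L R c a b d} → Corners L R c a b d → Corners (ts R) (ts L) (t d) (t b) (t a) (t c)
  corners-turn C = record
    { isTopLeft     = least-map t (turn-<ᵐ w) (isBottomRight C)
    ; isTopRight    = least-map t (turn-<ᶻ w) (isBottomLeft C)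
    ; isBottomLeft  = least-map t (turn-<ᶻ w) (isTopRight C)
    ; isBottomRight = least-map t (turn-<ᵐ w) (isTopLeft C)
    }

  across-turn⁺ : ∀ {c xs} → across c ∈ xs → across (t c) ∈ ts xs
  across-turn⁺ {c} p = subst (_∈ _) (turn-across w c) (∈-map⁺ t p)

  across-turn⁻ : ∀ {c xs} → across (t c) ∈ ts xs → across c ∈ xs
  across-turn⁻ {c} p = ∈-turn⁻ w (subst (_∈ _) (sym (turn-across w c)) p)

  witnessZ-turn : ∀ {L R c a b d} → WitnessZ L R c a b d →
                  WitnessZ (ts R) (ts L) (t d) (t b) (t a) (t c)
  witnessZ-turn {a = a} {b} (inj₁ a<b) = inj₁ (turn-row-< w {a} {b} a<b)
  witnessZ-turn {a = a} {b} (inj₂ (a≡b , inj₁ (u , p))) =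
    inj₂ (turn-row-≡ w {a} {b} a≡b , inj₂ (opposite-up u , across-turn⁺ p))
  witnessZ-turn {a = a} {b} (inj₂ (a≡b , inj₂ (v , p))) =
    inj₂ (turn-row-≡ w {a} {b} a≡b , inj₁ (opposite-down v , across-turn⁺ p))

  witnessM-turn : ∀ {L R c a b d} → WitnessM L R c a b d →
                  WitnessM (ts R) (ts L) (t d) (t b) (t a) (t c)
  witnessM-turn {a = a} {b} (a≡b , ¬b , ¬a) = turn-row-≡ w {a} {b} a≡b ,
    (λ (u , p) → ¬a (opposite-up⁻ u , across-turn⁻ p)) ,
    (λ (v , p) → ¬b (opposite-down⁻ v , across-turn⁻ p))

  replace-map : ∀ c d xs → ts (replace c d xs) ≋ replace (t c) (t d) (ts xs)
  replace-map c d xs = to , from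
    where
    to : ts (replace c d xs) ⊆ replace (t c) (t d) (ts xs)
    to x∈ with ∈-map⁻ t {xs = replace c d xs} x∈
    ... | x , x∈′ , refl with ∈-replace⁻ {c} {d} {xs} x∈′
    ...   | inj₁ refl         = here refl
    ...   | inj₂ (x∈xs , x≢c) = ∈-replace⁺ (∈-map⁺ t x∈xs) (x≢c ∘ turn-injective w)

    from : replace (t c) (t d) (ts xs) ⊆ ts (replace c d xs)
    from x∈ with ∈-replace⁻ {xs = ts xs} x∈
    ... | inj₁ refl = here refl
    ... | inj₂ (x∈ts , x≢tc) with ∈-map⁻ t {xs = xs} x∈ts
    ...   | x , x∈xs , refl = ∈-map⁺ t (∈-replace⁺ {c} {d} {xs} x∈xs λ { refl → x≢tc refl })

  sourceZ-turn : ∀ {L R c a b d S₁ S₂} → SourceZ L R c a b d S₁ S₂ →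
    ∃₂ λ S₁′ S₂′ → SourceZ (ts R) (ts L) (t d) (t b) (t a) (t c) S₁′ S₂′ × ts S₂ ≋ S₁′ × ts S₁ ≋ S₂′
  sourceZ-turn {a = a} {b} (asIs (inj₁ a<b)) =
    _ , _ , asIs (inj₁ (turn-row-< w {a} {b} a<b)) , (id , id) , (id , id)
  sourceZ-turn (asIs (inj₂ (u , v))) =
    _ , _ , asIs (inj₂ (opposite-down v , opposite-up u)) , (id , id) , (id , id)
  sourceZ-turn {L} {R} {c} {a} {b} {d} (swapˡ e u v) =
    _ , _ , swapʳ (turn-row-≡ w {a} {b} e) (opposite-up v) (opposite-up u) , (id , id) , replace-map c b L
  sourceZ-turn {L} {R} {c} {a} {b} {d} (swapʳ e u v) =
    _ , _ , swapˡ (turn-row-≡ w {a} {b} e) (opposite-down v) (opposite-down u) , replace-map d a R , (id , id)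

  next-turn⁺ : ∀ {c xs} → next c ∈ xs → prev (t c) ∈ ts xs
  next-turn⁺ {c} p = subst (_∈ _) (turn-next w c) (∈-map⁺ t p)

  next-turn⁻ : ∀ {c xs} → prev (t c) ∈ ts xs → next c ∈ xs
  next-turn⁻ {c} p = ∈-turn⁻ w (subst (_∈ _) (sym (turn-next w c)) p)

  prev-turn⁺ : ∀ {c xs} → prev c ∈ xs → next (t c) ∈ ts xs
  prev-turn⁺ {c} p = subst (_∈ _) (turn-prev w c) (∈-map⁺ t p)

  prev-turn⁻ : ∀ {c xs} → next (t c) ∈ ts xs → prev c ∈ xs
  prev-turn⁻ {c} p = ∈-turn⁻ w (subst (_∈ _) (sym (turn-prev w c)) p)

  sourceM-turn : ∀ {L R c a b d S₁ S₂} → SourceM L R c a b d S₁ S₂ →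
    ∃₂ λ S₁′ S₂′ → SourceM (ts R) (ts L) (t d) (t b) (t a) (t c) S₁′ S₂′ × ts S₂ ≋ S₁′ × ts S₁ ≋ S₂′
  sourceM-turn (asIs e) = _ , _ , asIs (cong opposite (sym e)) , (id , id) , (id , id)
  sourceM-turn {L} {R} {c} {a} {b} {d} (swapˡ u v p q) =
    _ , _ , swapʳ (opposite-down v) (opposite-up u) (q ∘ next-turn⁻ {b}) (prev-turn⁺ {a} p) ,
    (id , id) , replace-map a d L
  sourceM-turn {L} {R} {c} {a} {b} {d} (swapʳ u v p q) =
    _ , _ , swapˡ (opposite-down v) (opposite-up u) (next-turn⁺ {b} q) (p ∘ prev-turn⁻ {a}) ,
    replace-map b c R , (id , id)

  -- A half turn reverses both reading orders, so the two parts trade places, and with them the two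
  -- polyiamonds. These may be turned about `0ᵖ` whatever `w` is, since `Placed` absorbs the
  -- difference.
  outcome-turn : ∀ {ℓ m P₁ P₂ Q} → Outcome ℓ m P₁ P₂ Q →
                 Outcome m ℓ (map (turn 0ᵖ) P₂) (map (turn 0ᵖ) P₁) (ts Q)
  outcome-turn (zigzag {L} {R} {c} {a} {b} {d} K eq C W S p₁ p₂) =
    let (_ , _ , S′ , eq₁ , eq₂) = sourceZ-turn S in
    zigzag (cut-turn (turn-<ᶻ w) K) (++-turn L R eq) (corners-turn C)
      (witnessZ-turn {L} {R} {c} {a} {b} {d} W) S′
      (placed-≋ (placed-turn w p₂) eq₁) (placed-≋ (placed-turn w p₁) eq₂)
  outcome-turn (mirror {L} {R} {c} {a} {b} {d} K eq C W S p₁ p₂) =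
    let (_ , _ , S′ , eq₁ , eq₂) = sourceM-turn S in
    mirror (cut-turn (turn-<ᵐ w) K) (++-turn L R eq) (corners-turn C)
      (witnessM-turn {L} {R} {c} {a} {b} {d} W) S′
      (placed-≋ (placed-turn w p₂) eq₁) (placed-≋ (placed-turn w p₁) eq₂)

map-turn-involutive : ∀ w xs → map (turn w) (map (turn w) xs) ≡ xs
map-turn-involutive w xs = trans (sym (map-∘ xs)) (trans (map-cong (turn-involutive w) xs) (map-id xs))

-- Uniqueness of the parts

greatest-row : ∀ {_◃_ : Rel Cell 0ℓ} {xs a x} → Greatest (Swept _◃_) xs a → x ∈ xs → row x ℤ.≤ row a
greatest-row G x∈ with bound G x∈
... | inj₁ refl = ℤ.≤-refl
... | inj₂ x<a  = swept-row x<a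

least-row : ∀ {_◃_ : Rel Cell 0ℓ} {xs b x} → Least (Swept _◃_) xs b → x ∈ xs → row b ℤ.≤ row x
least-row G x∈ with bound G x∈
... | inj₁ refl = ℤ.≤-refl
... | inj₂ b<x  = swept-row b<x

greatest-rows : ∀ {_◃_ _◃′_ : Rel Cell 0ℓ} {xs a a′} →
                Greatest (Swept _◃_) xs a → Greatest (Swept _◃′_) xs a′ → row a ≡ row a′
greatest-rows A A′ = ℤ.≤-antisym (greatest-row A′ (member A)) (greatest-row A (member A′))

least-rows : ∀ {_◃_ _◃′_ : Rel Cell 0ℓ} {xs b b′} →
             Least (Swept _◃_) xs b → Least (Swept _◃′_) xs b′ → row b ≡ row b′
least-rows B B′ = ℤ.≤-antisym (least-row B (member B′)) (least-row B′ (member B))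

corners-unique : ∀ {L R L′ R′ c a b d c′ a′ b′ d′} → Corners L R c a b d → Corners L′ R′ c′ a′ b′ d′ →
                 L ≋ L′ → R ≋ R′ → (c ≡ c′ × a ≡ a′) × (b ≡ b′ × d ≡ d′)
corners-unique C C′ eqL eqR =
  (least-unique (Flip.isStrictTotalOrder <ᵐ-isStrictTotalOrder) (isTopLeft C) (isTopLeft C′) eqL ,
   least-unique (Flip.isStrictTotalOrder <ᶻ-isStrictTotalOrder) (isTopRight C) (isTopRight C′) eqL) ,
  (least-unique <ᶻ-isStrictTotalOrder (isBottomLeft C) (isBottomLeft C′) eqR ,
   least-unique <ᵐ-isStrictTotalOrder (isBottomRight C) (isBottomRight C′) eqR)

sourceZ-unique : ∀ {L R L′ R′ c a b d S₁ S₂ S₁′ S₂′} → SourceZ L R c a b d S₁ S₂ →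
                 SourceZ L′ R′ c a b d S₁′ S₂′ → L ≋ L′ → R ≋ R′ → S₁ ≋ S₁′ × S₂ ≋ S₂′
sourceZ-unique (asIs _)      (asIs _)      p q = p , q
sourceZ-unique (swapˡ _ _ _) (swapˡ _ _ _) p q = replace-cong p , q
sourceZ-unique (swapʳ _ _ _) (swapʳ _ _ _) p q = p , replace-cong q
sourceZ-unique (asIs (inj₁ a<b))       (swapˡ e _ _)        _ _ = contradiction a<b (ℤ.<-irrefl e)
sourceZ-unique (asIs (inj₁ a<b))       (swapʳ e _ _)        _ _ = contradiction a<b (ℤ.<-irrefl e)
sourceZ-unique (asIs (inj₂ (_ , v))) (swapˡ _ _ u)        _ _ = contradiction v (up≢down u)
sourceZ-unique (asIs (inj₂ (u , _))) (swapʳ _ v _)        _ _ = contradiction v (up≢down u)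
sourceZ-unique (swapˡ e _ _)        (asIs (inj₁ a<b))       _ _ = contradiction a<b (ℤ.<-irrefl e)
sourceZ-unique (swapʳ e _ _)        (asIs (inj₁ a<b))       _ _ = contradiction a<b (ℤ.<-irrefl e)
sourceZ-unique (swapˡ _ _ u)        (asIs (inj₂ (_ , v))) _ _ = contradiction v (up≢down u)
sourceZ-unique (swapʳ _ v _)        (asIs (inj₂ (u , _))) _ _ = contradiction v (up≢down u)
sourceZ-unique (swapˡ _ u _)        (swapʳ _ v _)         _ _ = contradiction v (up≢down u)
sourceZ-unique (swapʳ _ v _)        (swapˡ _ u _)         _ _ = contradiction v (up≢down u)

sourceM-unique : ∀ {L R L′ R′ c a b d S₁ S₂ S₁′ S₂′} → SourceM L R c a b d S₁ S₂ →
                 SourceM L′ R′ c a b d S₁′ S₂′ → L ≋ L′ → R ≋ R′ → S₁ ≋ S₁′ × S₂ ≋ S₂′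
sourceM-unique (asIs _)        (asIs _)        p q = p , q
sourceM-unique (swapˡ _ _ _ _) (swapˡ _ _ _ _) p q = replace-cong p , q
sourceM-unique (swapʳ _ _ _ _) (swapʳ _ _ _ _) p q = p , replace-cong q
sourceM-unique (asIs e)        (swapˡ u v _ _) _ _ = contradiction (trans e v) (up≢down u)
sourceM-unique (asIs e)        (swapʳ u v _ _) _ _ = contradiction (trans e v) (up≢down u)
sourceM-unique (swapˡ u v _ _) (asIs e)        _ _ = contradiction (trans e v) (up≢down u)
sourceM-unique (swapʳ u v _ _) (asIs e)        _ _ = contradiction (trans e v) (up≢down u)
sourceM-unique (swapˡ _ _ h _) (swapʳ _ _ ¬h _) p _ = contradiction (proj₁ p h) ¬h
sourceM-unique (swapʳ _ _ ¬h _) (swapˡ _ _ h _) p _ = contradiction (proj₂ p h) ¬h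

-- If the row shared by L and R is below that of L′ and R′, then L′ contains
-- L as well as a cell of R.
shared-row-≮ : ∀ {_◃_ _◃′_ : Rel Cell 0ℓ} {ℓ m L R L′ R′ c a b d c′ a′ b′ d′} →
  IsStrictTotalOrder _≡_ (Swept _◃_) → Cut (Swept _◃_) ℓ m L R → Cut (Swept _◃′_) ℓ m L′ R′ →
  Corners L R c a b d → Corners L′ R′ c′ a′ b′ d′ → L ++ R ⊆ L′ ++ R′ →
  row a ≡ row b → row a′ ≡ row b′ → ¬ row a ℤ.< row a′
shared-row-≮ {L = L} {R} {L′ = L′} {a = a} {b} O K K′ C C′ Q⊆Q′ a≡b a′≡b′ a<a′ = ℕ.1+n≰n
  (subst₂ _≤_ (cong suc (sizeˡ K)) (sizeˡ K′)
    (unique-⊆⇒length≤ {b ∷ L} {L′}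
      (¬Any⇒All¬ _ (λ b∈L → cut-disjoint O K b∈L (member (isBottomLeft C))) ∷ uniqueˡ K)
      λ { (here refl) → low (∈-++⁺ʳ L (member (isBottomLeft C))) (ℤ.≤-reflexive (sym a≡b))
        ; (there x∈)  → low (∈-++⁺ˡ x∈) (greatest-row (isTopRight C) x∈) }))
  where
  low : ∀ {x} → x ∈ L ++ R → row x ℤ.≤ row a → x ∈ L′
  low x∈Q x≤a with ∈-++⁻ L′ (Q⊆Q′ x∈Q)
  ... | inj₁ x∈L′ = x∈L′
  ... | inj₂ x∈R′ = contradiction (ℤ.<-≤-trans (ℤ.≤-<-trans x≤a a<a′)
      (subst (ℤ._≤ _) (sym a′≡b′) (least-row (isBottomLeft C′) x∈R′))) (ℤ.<-irrefl refl)

module _ {ℓ m L R L′ R′ c a b d c′ a′ b′ d′} (K : Cut _<ᵐ_ ℓ m L R) (K′ : Cut _<ᶻ_ ℓ m L′ R′)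
  (C : Corners L R c a b d) (C′ : Corners L′ R′ c′ a′ b′ d′) (eq : L ++ R ≋ L′ ++ R′)
  (a≡b : row a ≡ row b) where

  -- Parts in disjoint ranges of rows are cut in either reading order. By uniqueness of the `<ᵐ` cut
  -- they would agree with `L` and `R`, which share a row.
  mixed-≮ : ¬ row a′ ℤ.< row b′
  mixed-≮ a′<b′ = ℤ.<-irrefl a≡b (ℤ.≤-<-trans
    (greatest-row (isTopRight C′) (proj₁ (proj₁ same) (member (isTopRight C))))
    (ℤ.<-≤-trans a′<b′ (least-row (isBottomLeft C′) (proj₁ (proj₂ same) (member (isBottomLeft C))))))
    where
    K″ : Cut _<ᵐ_ ℓ m L′ R′
    K″ = record { Cut K′ ; before = λ x∈ y∈ → lower (ℤ.≤-<-trans (greatest-row (isTopRight C′) x∈)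
           (ℤ.<-≤-trans a′<b′ (least-row (isBottomLeft C′) y∈))) }
    same = cut-unique <ᵐ-isStrictTotalOrder K K″ eq

  module _ (a′≡b′ : row a′ ≡ row b′) where

    mixed-row : row a ≡ row a′
    mixed-row with ℤ.<-cmp (row a) (row a′)
    ... | tri≈ _ e _ = e
    ... | tri< p _ _ = contradiction p (shared-row-≮ <ᵐ-isStrictTotalOrder K K′ C C′ (proj₁ eq) a≡b a′≡b′)
    ... | tri> _ _ p = contradiction p (shared-row-≮ <ᶻ-isStrictTotalOrder K′ K C′ C (proj₂ eq) a′≡b′ a≡b)

    private
      c′~b : row c′ ≡ row b
      c′~b = trans (greatest-rows (isTopLeft C′) (isTopRight C′)) (trans (sym mixed-row) a≡b)

      d′~a : row d′ ≡ row a
      d′~a = trans (least-rows (isBottomRight C′) (isBottomLeft C′)) (trans (sym a′≡b′) (sym mixed-row))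

      asym : ∀ {x y} → x ◁ y → ¬ y ◁ x
      asym p q = ◁-irrefl (◁-trans p q)

    -- In the shared row `<ᵐ` puts `R` to the left of `L`, and `<ᶻ` puts `L′` to the left of `R′`.
    -- Hence `b` and `c′` are both the leftmost cell of that row in the common union.
    mixed-leftmost : c′ ≡ b
    mixed-leftmost with ◁-connex c′ b c′~b
    ... | inj₁ e = e
    ... | inj₂ (inj₁ c′◁b) =
      ⊥-elim (Sum.[ inL , inR ] (∈-++⁻ L (proj₂ eq (∈-++⁺ˡ (member (isTopLeft C′))))))
      where
      inL : ¬ c′ ∈ L
      inL c′∈L = asym c′◁b (swept-along c′~b (before K c′∈L (member (isBottomLeft C))))
      inR : ¬ c′ ∈ R
      inR c′∈R with bound (isBottomLeft C) c′∈R
      ... | inj₁ refl = ◁-irrefl c′◁b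
      ... | inj₂ b<c′ = asym c′◁b (swept-along (sym c′~b) b<c′)
    ... | inj₂ (inj₂ b◁c′) =
      ⊥-elim (Sum.[ inL , inR ] (∈-++⁻ L′ (proj₁ eq (∈-++⁺ʳ L (member (isBottomLeft C))))))
      where
      inL : ¬ b ∈ L′
      inL b∈L′ with bound (isTopLeft C′) b∈L′
      ... | inj₁ refl = ◁-irrefl b◁c′
      ... | inj₂ b<c′ = asym b◁c′ (swept-along (sym c′~b) b<c′)
      inR : ¬ b ∈ R′
      inR b∈R′ = asym b◁c′ (swept-along c′~b (before K′ (member (isTopLeft C′)) b∈R′))

    -- The same argument at the right end of the row, which is occupied by `L` and by `R′`.
    mixed-rightmost : d′ ≡ a
    mixed-rightmost with ◁-connex d′ a d′~a
    ... | inj₁ e = e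
    ... | inj₂ (inj₁ d′◁a) =
      ⊥-elim (Sum.[ inL , inR ] (∈-++⁻ L′ (proj₁ eq (∈-++⁺ˡ (member (isTopRight C))))))
      where
      inL : ¬ a ∈ L′
      inL a∈L′ = asym d′◁a (swept-along (sym d′~a) (before K′ a∈L′ (member (isBottomRight C′))))
      inR : ¬ a ∈ R′
      inR a∈R′ with bound (isBottomRight C′) a∈R′
      ... | inj₁ refl = ◁-irrefl d′◁a
      ... | inj₂ d′<a = asym d′◁a (swept-along d′~a d′<a)
    ... | inj₂ (inj₂ a◁d′) =
      ⊥-elim (Sum.[ inL , inR ] (∈-++⁻ L (proj₂ eq (∈-++⁺ʳ L′ (member (isBottomRight C′))))))
      where
      inL : ¬ d′ ∈ L
      inL d′∈L with bound (isTopRight C) d′∈L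
      ... | inj₁ refl = ◁-irrefl a◁d′
      ... | inj₂ d′<a = asym a◁d′ (swept-along d′~a d′<a)
      inR : ¬ d′ ∈ R
      inR d′∈R = asym a◁d′ (swept-along (sym d′~a) (before K (member (isTopRight C)) d′∈R))

-- The ends of the shared row being the same for both cuts, a contact demanded by `WitnessZ` is one
-- that `WitnessM` excludes: the cell below `b` is too low for `R`, so it would lie in `L`, and the
-- cell above `a` is too high for `L`, so it would lie in `R`.
mixed-⊥ : ∀ {ℓ m L R L′ R′ c a b d c′ a′ b′ d′} → Cut _<ᵐ_ ℓ m L R → Cut _<ᶻ_ ℓ m L′ R′ →
  Corners L R c a b d → Corners L′ R′ c′ a′ b′ d′ → L ++ R ≋ L′ ++ R′ →
  WitnessM L R c a b d → WitnessZ L′ R′ c′ a′ b′ d′ → ⊥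
mixed-⊥ K K′ C C′ eq (a≡b , _) (inj₁ a′<b′) = mixed-≮ K K′ C C′ eq a≡b a′<b′
mixed-⊥ {L = L} {L′ = L′} K K′ C C′ eq (a≡b , ¬b , _) (inj₂ (a′≡b′ , inj₁ (u , p)))
  with mixed-leftmost K K′ C C′ eq a≡b a′≡b′ | ∈-++⁻ L (proj₂ eq (∈-++⁺ˡ p))
... | refl | inj₁ q = ¬b (u , q)
... | refl | inj₂ q = ℤ.<-irrefl refl (ℤ.<-≤-trans (row-across-up u) (least-row (isBottomLeft C) q))
mixed-⊥ {L = L} {L′ = L′} K K′ C C′ eq (a≡b , _ , ¬a) (inj₂ (a′≡b′ , inj₂ (v , p)))
  with mixed-rightmost K K′ C C′ eq a≡b a′≡b′ | ∈-++⁻ L (proj₂ eq (∈-++⁺ʳ L′ p))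
... | refl | inj₁ q = ℤ.<-irrefl refl (ℤ.<-≤-trans (row-across-down v) (greatest-row (isTopRight C) q))
... | refl | inj₂ q = ¬a (v , q)

-- With equal reading orders the cut is determined by `Q`, then the corners by the cut, then the
-- sources by the corners. Different orders are incompatible by `mixed-⊥`.
outcome-injective : ∀ {ℓ m} {P₁ P₁′ : Polyiamond ℓ} {P₂ P₂′ : Polyiamond m} {Q} →
  Outcome ℓ m (cells P₁) (cells P₂) Q → Outcome ℓ m (cells P₁′) (cells P₂′) Q → P₁ ≈ P₁′ × P₂ ≈ P₂′
outcome-injective {P₁ = P₁} {P₁′} {P₂} {P₂′} (zigzag K eq C _ S p₁ p₂) (zigzag K′ eq′ C′ _ S′ p₁′ p₂′)
  with cut-unique <ᶻ-isStrictTotalOrder K K′ (≋-trans eq (≋-sym eq′))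
... | eqL , eqR with corners-unique C C′ eqL eqR
...   | (refl , refl) , (refl , refl) with sourceZ-unique S S′ eqL eqR
...     | e₁ , e₂ = placed-≈ {P = P₁} {P₁′} (placed-≋ p₁ e₁) p₁′ , placed-≈ {P = P₂} {P₂′} (placed-≋ p₂ e₂) p₂′
outcome-injective {P₁ = P₁} {P₁′} {P₂} {P₂′} (mirror K eq C _ S p₁ p₂) (mirror K′ eq′ C′ _ S′ p₁′ p₂′)
  with cut-unique <ᵐ-isStrictTotalOrder K K′ (≋-trans eq (≋-sym eq′))
... | eqL , eqR with corners-unique C C′ eqL eqR
...   | (refl , refl) , (refl , refl) with sourceM-unique S S′ eqL eqR
...     | e₁ , e₂ = placed-≈ {P = P₁} {P₁′} (placed-≋ p₁ e₁) p₁′ , placed-≈ {P = P₂} {P₂′} (placed-≋ p₂ e₂) p₂′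
outcome-injective (mirror K eq C W _ _ _) (zigzag K′ eq′ C′ W′ _ _ _) =
  ⊥-elim (mixed-⊥ K K′ C C′ (≋-trans eq (≋-sym eq′)) W W′)
outcome-injective (zigzag K′ eq′ C′ W′ _ _ _) (mirror K eq C W _ _ _) =
  ⊥-elim (mixed-⊥ K K′ C C′ (≋-trans eq (≋-sym eq′)) W W′)

outcome-≈ : ∀ {ℓ m n P₁ P₂} {Q Q′ : Polyiamond n} → Outcome ℓ m P₁ P₂ (cells Q) → Q ≈ Q′ →
            Outcome ℓ m P₁ P₂ (cells Q′)
outcome-≈ {P₁ = P₁} {P₂} {Q} {Q′} out (v , f) =
  -- The two half turns translate `Q` by `v`, while `P₁` and `P₂` are turned twice about `0ᵖ` and so
  -- return to themselves.
  subst₂ (λ P P′ → Outcome _ _ P P′ (cells Q′)) (map-turn-involutive 0ᵖ P₁) (map-turn-involutive 0ᵖ P₂)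
    (outcome-≋ (outcome-turn v (outcome-turn 0ᵖ out)) (to , from))
  where
  double : ∀ c → turn v (turn 0ᵖ c) ≡ translate v c
  double c = trans (turn-turn v 0ᵖ c) (cong (λ u → translate u c) (trans (⊕-comm v 0ᵖ) (⊕-identityˡ v)))

  to : map (turn v) (map (turn 0ᵖ) (cells Q)) ⊆ cells Q′
  to x∈ with ∈-map⁻ (turn v) {xs = map (turn 0ᵖ) (cells Q)} x∈
  ... | _ , y∈ , refl with ∈-map⁻ (turn 0ᵖ) {xs = cells Q} y∈
  ...   | c , c∈Q , refl = subst (_∈ cells Q′) (sym (double c)) (Equivalence.to (f c) c∈Q)

  from : cells Q′ ⊆ map (turn v) (map (turn 0ᵖ) (cells Q))
  from {c} c∈ = subst (_∈ _) (trans (double _) (translate-⊖ʳ v c))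
    (∈-map⁺ (turn v) (∈-map⁺ (turn 0ᵖ)
      (Equivalence.from (f _) (subst (_∈ cells Q′) (sym (translate-⊖ʳ v c)) c∈))))

-- Gluing two polyiamonds

image : ∀ {n} (f : Cell → Cell) → (∀ {c d} → f c ≡ f d → c ≡ d) →
        (∀ {c d} → Neighbour c d → Neighbour (f c) (f d)) → Polyiamond n → Polyiamond n
image f inj mono P = record
  { cells     = map f (cells P)
  ; unique    = Unique.map⁺ inj (unique P)
  ; size      = trans (length-map f (cells P)) (size P)
  ; connected = conn
  }
  where
  step : ∀ {c d} → AdjacentIn (cells P) c d → AdjacentIn (map f (cells P)) (f c) (f d)
  step (c∈ , d∈ , adj) = ∈-map⁺ f c∈ , ∈-map⁺ f d∈ , neighbour⇒adjacent (mono (adjacent⇒neighbour adj))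

  conn : Connected (map f (cells P))
  conn c∈ d∈ with ∈-map⁻ f {xs = cells P} c∈ | ∈-map⁻ f {xs = cells P} d∈
  ... | _ , c∈P , refl | _ , d∈P , refl = Star.gmap f step (connected P c∈P d∈P)

place : ∀ {n} → Point → Polyiamond n → Polyiamond n
place u = image (translate u) (translate-injective u) (translate-neighbour u)

turned : ∀ {n} → Polyiamond n → Polyiamond n
turned = image (turn 0ᵖ) (turn-injective 0ᵖ) (turn-neighbour 0ᵖ)

translate-row-≡ : ∀ u {c d} → row c ≡ row d → row (translate u c) ≡ row (translate u d)
translate-row-≡ u = cong (λ y → proj₂ u ℤ.+ y)

translate-row-≡⁻ : ∀ u {c d} → row (translate u c) ≡ row (translate u d) → row c ≡ row d
translate-row-≡⁻ u {c} {d} e =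
  cong proj₂ (⊕-injective (0ℤ , proj₂ u) {0ℤ , row c} {0ℤ , row d} (cong (0ℤ ,_) e))

translate-◁ : ∀ u {c d} → c ◁ d → translate u c ◁ translate u d
translate-◁ u (apart p)      = apart (ℤ.+-monoʳ-< (proj₁ u) p)
translate-◁ u (halves p q r) = halves (cong (λ x → proj₁ u ℤ.+ x) p) q r

translate-<ᶻ : ∀ u {c d} → c <ᶻ d → translate u c <ᶻ translate u d
translate-<ᶻ u (lower p)           = lower (ℤ.+-monoʳ-< (proj₂ u) p)
translate-<ᶻ u {c} {d} (along p q) = along (translate-row-≡ u {c} {d} p) (translate-◁ u q)

translate-<ᵐ : ∀ u {c d} → c <ᵐ d → translate u c <ᵐ translate u d
translate-<ᵐ u (lower p)           = lower (ℤ.+-monoʳ-< (proj₂ u) p)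
translate-<ᵐ u {c} {d} (along p q) = along (translate-row-≡ u {c} {d} p) (translate-◁ u q)

-- `Least Above` thus singles out any cell of the top row, and `Least (flip Above)` any cell of the
-- bottom row.
Above : Rel Cell 0ℓ
Above c d = row d ℤ.≤ row c

translate-Above : ∀ u {c d} → Above c d → Above (translate u c) (translate u d)
translate-Above u = ℤ.+-monoʳ-≤ (proj₂ u)

Flat : Orientation → List Cell → ℤ → Set
Flat o xs y = ∀ {x} → x ∈ xs → row x ≡ y → orient x ≡ o

flat? : ∀ o xs y → Flat o xs y ⊎ ∃ λ x → x ∈ xs × row x ≡ y × orient x ≢ o
flat? o xs y with any? (λ x → (row x ℤ.≟ y) ×-dec ¬? (orient x ≟ᵒ o)) xs
... | yes p = let (x , x∈ , e , n) = find p in inj₂ (x , x∈ , e , n)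
... | no ¬p = inj₁ λ {x} x∈ e → decide x x∈ e
  where
  decide : ∀ x → x ∈ xs → row x ≡ y → orient x ≡ o
  decide x x∈ e with orient x ≟ᵒ o
  ... | yes q = q
  ... | no ¬q = contradiction (lose x∈ (e , ¬q)) ¬p

shift : Cell → Cell → Point
shift a t = proj₁ t ⊕ (⊖ proj₁ a)

shift-to : ∀ {a t} → orient a ≡ orient t → translate (shift a t) a ≡ t
shift-to {p , o} {q , _} refl = cong (_, o) (⊕-cancelʳ′ q p)

least-place : ∀ {_≺_ : Rel Cell 0ℓ} → (∀ u {c d} → c ≺ d → translate u c ≺ translate u d) →
  ∀ {n} (P : Polyiamond n) {a t} → orient a ≡ orient t →
  Least _≺_ (cells P) a → Least _≺_ (cells (place (shift a t) P)) t
least-place mono P {a} {t} o≡ A =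
  subst (Least _ _) (shift-to {a} {t} o≡) (least-map (translate (shift a t)) (mono (shift a t)) A)

flat-place : ∀ {n} (P : Polyiamond n) {o a t} → orient a ≡ orient t →
  Flat o (cells P) (row a) → Flat o (cells (place (shift a t) P)) (row t)
flat-place P {a = a} {t} o≡ F x∈ e with ∈-map⁻ (translate (shift a t)) {xs = cells P} x∈
... | x , x∈P , refl = F x∈P (translate-row-≡⁻ (shift a t) {x} {a}
  (trans e (cong row (sym (shift-to {a} {t} o≡)))))

placed-refl : ∀ {xs} → Placed xs xs
placed-refl {xs} = 0ᵖ , subst (_≋ xs) (sym (trans (map-cong translate-0ᵖ xs) (map-id xs))) (id , id)

placed-place : ∀ {n} u (P : Polyiamond n) → Placed (cells P) (cells (place u P))
placed-place u P = u , id , id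

placed-trans : ∀ {P P′ S} → Placed P P′ → Placed P′ S → Placed P S
placed-trans {P} {P′} {S} (u , eq) (v , eq′) = v ⊕ u ,
  subst (_≋ S) (sym (trans (map-cong (translate-⊕ v u) P) (map-∘ P))) (≋-trans (map-≋ (translate v) eq) eq′)

outcome-placed : ∀ {ℓ m P₁ P₁′ P₂ P₂′ Q} → Placed P₁ P₁′ → Placed P₂ P₂′ →
                 Outcome ℓ m P₁′ P₂′ Q → Outcome ℓ m P₁ P₂ Q
outcome-placed p q (zigzag K eq C W S p₁ p₂) = zigzag K eq C W S (placed-trans p p₁) (placed-trans q p₂)
outcome-placed p q (mirror K eq C W S p₁ p₂) = mirror K eq C W S (placed-trans p p₁) (placed-trans q p₂)

reach : ∀ {n} (P : Polyiamond n) {Q x y} → cells P ⊆ Q → x ∈ cells P → y ∈ cells P → Star (AdjacentIn Q) x y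
reach P P⊆Q x∈ y∈ = Star.map (λ (p , q , adj) → P⊆Q p , P⊆Q q , adj) (connected P x∈ y∈)

hub-connected : ∀ {Q h} → (∀ {x} → x ∈ Q → Star (AdjacentIn Q) h x) → Connected Q
hub-connected hub x∈ y∈ = Star.reverse (λ (p , q , adj) → q , p , adjacent-sym adj) (hub x∈) ◅◅ hub y∈

join-connected : ∀ {ℓ m} (P₁ : Polyiamond ℓ) (P₂ : Polyiamond m) {x y} →
  x ∈ cells P₁ → y ∈ cells P₂ → Neighbour x y → Connected (cells P₁ ++ cells P₂)
join-connected P₁ P₂ x∈ y∈ n = hub-connected λ z∈ → Sum.[
  reach P₁ ∈-++⁺ˡ x∈ ,
  (λ z∈P₂ → (∈-++⁺ˡ x∈ , ∈-++⁺ʳ (cells P₁) y∈ , neighbour⇒adjacent n) ◅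
             reach P₂ (∈-++⁺ʳ (cells P₁)) y∈ z∈P₂) ]
  (∈-++⁻ (cells P₁) z∈)

glue : ∀ {_≺_} (O : IsStrictTotalOrder _≡_ _≺_) {ℓ m L R} →
       Cut _≺_ ℓ m L R → Connected (L ++ R) → Polyiamond (ℓ + m)
glue O {L = L} {R} K conn = record
  { cells     = L ++ R
  ; unique    = Unique.++⁺ (uniqueˡ K) (uniqueʳ K) λ (p , q) → cut-disjoint O K p q
  ; size      = trans (length-++ L) (cong₂ _+_ (sizeˡ K) (sizeʳ K))
  ; connected = conn
  }

cells-cut : ∀ {_≺_ : Rel Cell 0ℓ} {ℓ m} (P₁ : Polyiamond ℓ) (P₂ : Polyiamond m) →
  (∀ {x y} → x ∈ cells P₁ → y ∈ cells P₂ → x ≺ y) → Cut _≺_ ℓ m (cells P₁) (cells P₂)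
cells-cut P₁ P₂ before = record
  { uniqueˡ = unique P₁ ; uniqueʳ = unique P₂ ; sizeˡ = size P₁ ; sizeʳ = size P₂ ; before = before }

sandwich : ∀ {_≺_} (O : IsStrictTotalOrder _≡_ _≺_) {L R a b x y} → Greatest _≺_ L a → a ≺ b → Least _≺_ R b →
           x ∈ L → y ∈ R → x ≺ y
sandwich O A a<b B x∈ y∈ with bound A x∈
... | inj₁ refl = ≺-≼-trans O a<b (bound B y∈)
... | inj₂ x<a  = IsStrictTotalOrder.trans O x<a (≺-≼-trans O a<b (bound B y∈))

other : ∀ {n} (P : Polyiamond n) → 2 ≤ n → ∀ x → ∃ λ y → y ∈ cells P × x ≢ y
other P 2≤n x with cells P | unique P | size P
other P () x | [] | _ | refl
other P (s≤s ()) x | _ ∷ [] | _ | refl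
... | p ∷ q ∷ _ | (p≢q ∷ _) ∷ _ | _ with x ≟ᶜ p
...   | yes refl = q , there (here refl) , p≢q
...   | no  x≢p  = p , here refl , x≢p

has-neighbour : ∀ {n} (P : Polyiamond n) → 2 ≤ n → ∀ {x} → x ∈ cells P → ∃ λ y → y ∈ cells P × Neighbour x y
has-neighbour P 2≤n {x} x∈ with other P 2≤n x
... | y , y∈ , x≢y with connected P x∈ y∈
...   | ε = contradiction refl x≢y
...   | (_ , z∈ , adj) ◅ _ = _ , z∈ , adjacent⇒neighbour adj

opposite-≢ : ∀ o → opposite o ≢ o
opposite-≢ up   ()
opposite-≢ down ()

-- Neighbours within a row have opposite orientations, so a cell of a flat row can only be attached
-- through its horizontal edge.
flat-across : ∀ {n} (P : Polyiamond n) → 2 ≤ n → ∀ {x} → x ∈ cells P → Flat (orient x) (cells P) (row x) →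
              across x ∈ cells P
flat-across P 2≤n {x} x∈ F with has-neighbour P 2≤n x∈
... | _ , p , outward = p
... | _ , p , right   = contradiction (trans (sym (orient-next x)) (F p (row-next x))) (opposite-≢ _)
... | _ , p , left    = contradiction (trans (sym (orient-prev x)) (F p (row-prev x))) (opposite-≢ _)

prev-<ᶻ : ∀ b → prev b <ᶻ b
prev-<ᶻ b = along (row-prev b) (prev-◁ b)

<ᵐ-prev : ∀ b → b <ᵐ prev b
<ᵐ-prev b = along (sym (row-prev b)) (prev-◁ b)

next-<ᵐ : ∀ b → next b <ᵐ b
next-<ᵐ b = along (row-next b) (◁-next b)

<ᶻ-next : ∀ b → b <ᶻ next b
<ᶻ-next b = along (sym (row-next b)) (◁-next b)

not-less : ∀ {_≺_} (O : IsStrictTotalOrder _≡_ _≺_) {xs b x} → Least _≺_ xs b → x ≺ b → x ∉ xs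
not-less O B x<b x∈ = IsStrictTotalOrder.irrefl O refl (≺-≼-trans O x<b (bound B x∈))

-- The other two neighbours of an up cell, to the left and below, would precede the first cell.
next-of-bottomLeft : ∀ {n} (P : Polyiamond n) → 2 ≤ n → ∀ {b} →
                     Least _<ᶻ_ (cells P) b → Up b → next b ∈ cells P
next-of-bottomLeft P 2≤n {b} B u with has-neighbour P 2≤n (member B)
... | _ , p , right   = p
... | _ , p , left    = contradiction p (not-less <ᶻ-isStrictTotalOrder B (prev-<ᶻ b))
... | _ , p , outward = contradiction p (not-less <ᶻ-isStrictTotalOrder B (lower (row-across-up u)))

Combination : ∀ {ℓ m} → Polyiamond ℓ → Polyiamond m → Set
Combination {ℓ} {m} P₁ P₂ = Σ[ Q ∈ Polyiamond (ℓ + m) ] Outcome ℓ m (cells P₁) (cells P₂) (cells Q)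

topLeft : ∀ {x L} → x ∈ L → ∃ (Greatest _<ᵐ_ L)
topLeft = least-exists (Flip.isStrictTotalOrder <ᵐ-isStrictTotalOrder)

topRight : ∀ {x L} → x ∈ L → ∃ (Greatest _<ᶻ_ L)
topRight = least-exists (Flip.isStrictTotalOrder <ᶻ-isStrictTotalOrder)

bottomLeft : ∀ {x R} → x ∈ R → ∃ (Least _<ᶻ_ R)
bottomLeft = least-exists <ᶻ-isStrictTotalOrder

bottomRight : ∀ {x R} → x ∈ R → ∃ (Least _<ᵐ_ R)
bottomRight = least-exists <ᵐ-isStrictTotalOrder

-- The five ways of gluing

module _ {ℓ m} (P₁ : Polyiamond ℓ) (P₂ : Polyiamond m) where

  -- The horizontal edge of `x` joins the two polyiamonds, which occupy disjoint ranges of rows.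
  stack : ∀ {x} → Least Above (cells P₁) x → Down x →
          Least (flip Above) (cells P₂) (across x) → Combination P₁ P₂
  stack {x} X v Y =
    let (_ , C) = topLeft (member X) ; (a , A) = topRight (member X)
        (b , B) = bottomLeft (member Y) ; (_ , D) = bottomRight (member Y)
        a<b = ℤ.≤-<-trans (X≤ (member A)) (ℤ.<-≤-trans (row-across-down v) (Y≤ (member B)))
    in glue <ᶻ-isStrictTotalOrder K (join-connected P₁ P₂ (member X) (member Y) outward) ,
       zigzag K (id , id) record { isTopLeft = C ; isTopRight = A ; isBottomLeft = B ; isBottomRight = D }
         (inj₁ a<b) (asIs (inj₁ a<b)) placed-refl placed-refl
    where
    X≤ : ∀ {y} → y ∈ cells P₁ → row y ℤ.≤ row x
    X≤ y∈ with bound X y∈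
    ... | inj₁ refl = ℤ.≤-refl
    ... | inj₂ y≤x  = y≤x

    Y≤ : ∀ {y} → y ∈ cells P₂ → row (across x) ℤ.≤ row y
    Y≤ y∈ with bound Y y∈
    ... | inj₁ refl = ℤ.≤-refl
    ... | inj₂ x≤y  = x≤y

    K : Cut _<ᶻ_ ℓ m (cells P₁) (cells P₂)
    K = cells-cut P₁ P₂ λ y∈ z∈ → lower (ℤ.≤-<-trans (X≤ y∈) (ℤ.<-≤-trans (row-across-down v) (Y≤ z∈)))

  -- Flatness of one of the two rows provides the contact for `WitnessZ`: the far end of that row is
  -- attached to its own polyiamond only through its horizontal edge.
  append : 2 ≤ ℓ → 2 ≤ m → ∀ {a b} → Greatest _<ᶻ_ (cells P₁) a → Least _<ᶻ_ (cells P₂) b → b ≡ next a →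
           Up a → Flat up (cells P₁) (row a) ⊎ Flat down (cells P₂) (row b) → Combination P₁ P₂
  append 2≤ℓ 2≤m {a} A B refl u F =
    let (c , C) = topLeft (member A) ; (d , D) = bottomRight (member B)
    in glue <ᶻ-isStrictTotalOrder K (join-connected P₁ P₂ (member A) (member B) right) ,
       zigzag K (id , id) record { isTopLeft = C ; isTopRight = A ; isBottomLeft = B ; isBottomRight = D }
         (inj₂ (sym (row-next a) , contact C D F)) (asIs (inj₂ (u , trans (orient-next a) (opposite-up u))))
         placed-refl placed-refl
    where
    K : Cut _<ᶻ_ ℓ m (cells P₁) (cells P₂)
    K = cells-cut P₁ P₂ (sandwich <ᶻ-isStrictTotalOrder A (<ᶻ-next a) B)

    contact : ∀ {c d} → Greatest _<ᵐ_ (cells P₁) c → Least _<ᵐ_ (cells P₂) d →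
      Flat up (cells P₁) (row a) ⊎ Flat down (cells P₂) (row (next a)) →
      (Up c × across c ∈ cells P₁) ⊎ (Down d × across d ∈ cells P₂)
    contact {c} C D (inj₁ F) = inj₁ (uc , flat-across P₁ 2≤ℓ (member C)
      λ {x} x∈ e → trans (F x∈ (trans e (greatest-rows C A))) (sym uc))
      where uc = F (member C) (greatest-rows C A)
    contact {d = d} C D (inj₂ F) = inj₂ (vd , flat-across P₂ 2≤m (member D)
      λ {x} x∈ e → trans (F x∈ (trans e (least-rows D B))) (sym vd))
      where vd = F (member D) (least-rows D B)

  -- `P₁` continues the bottom row of `P₂` to the right, so it comes first when rows are read from
  -- right to left. The absence of a cell of `P₁` below `b` gives `WitnessM`.
  prepend : ∀ {b t} → Least _<ᶻ_ (cells P₂) b → Up b → Least _<ᵐ_ (cells P₂) t →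
            Greatest _<ᵐ_ (cells P₁) (next t) → Flat up (cells P₁) (row (next t)) → across b ∉ cells P₁ →
            Down t → Combination P₁ P₂
  prepend {b} {t} B ub D C F ¬p vt =
    let (a , A) = topRight (member C)
        a~t = trans (greatest-rows A C) (row-next t)
        ua = F (member A) (greatest-rows A C)
    in glue <ᵐ-isStrictTotalOrder K conn ,
       mirror K (id , id) record { isTopLeft = C ; isTopRight = A ; isBottomLeft = B ; isBottomRight = D }
         (trans a~t (least-rows D B) , (λ (_ , p) → ¬p p) , λ (v , _) → up≢down ua v)
         (asIs (trans ua (sym ub))) placed-refl placed-refl
    where
    K : Cut _<ᵐ_ ℓ m (cells P₁) (cells P₂)
    K = cells-cut P₁ P₂ (sandwich <ᵐ-isStrictTotalOrder C (next-<ᵐ t) D)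

    conn : Connected (cells P₁ ++ cells P₂)
    conn = join-connected P₁ P₂ (member C) (member D) (subst (Neighbour (next t)) (prev-next t) left)

  -- Both ends to be joined are up cells, so they are made to coincide in `t`, and `P₂` receives
  -- `prev b` in exchange for `t`. The new left end is a down cell and `a` is an up cell, so
  -- `WitnessM` holds vacuously.
  overlay : 2 ≤ m → ∀ {b t} → Least _<ᶻ_ (cells P₂) b → Up b → Least _<ᵐ_ (cells P₂) t →
            Greatest _<ᵐ_ (cells P₁) t → Flat up (cells P₁) (row t) → Combination P₁ P₂
  overlay 2≤m {b} {t} B ub D C F =
    let (a , A) = topRight (member C) ; (_ , D′) = bottomRight {R = R} (here refl)
        a~t = greatest-rows A C
        ua = F (member A) a~t
    in glue <ᵐ-isStrictTotalOrder K (hub-connected hub) ,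
       mirror K (id , id) record { isTopLeft = C ; isTopRight = A ; isBottomLeft = B′ ; isBottomRight = D′ }
         (trans a~t (trans (least-rows D B) (sym (row-prev b))) ,
          (λ (u , _) → up≢down u vb) , λ (v , _) → up≢down ua v)
         (swapʳ ua vb
           (λ p → up≢down (F p (trans (row-prev a) a~t)) (trans (orient-prev a) (opposite-up ua)))
           (subst (_∈ R) (sym (next-prev b)) (∈-replace⁺ {t} {prev b} {cells P₂} (member B) b≢t)))
         placed-refl (placed-≋ placed-refl (≋-sym (replace-undo (member D) prev-b∉)))
    where
    R = replace t (prev b) (cells P₂)

    vb : Down (prev b)
    vb = trans (orient-prev b) (opposite-up ub)

    b≢t : b ≢ t
    -- Otherwise `next b`, a cell of `P₂`, would lie to the right of the rightmost cell of its row.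
    b≢t refl = not-less <ᵐ-isStrictTotalOrder D (next-<ᵐ b) (next-of-bottomLeft P₂ 2≤m B ub)

    prev-b∉ : prev b ∉ cells P₂
    prev-b∉ = not-less <ᶻ-isStrictTotalOrder B (prev-<ᶻ b)

    B′ : Least _<ᶻ_ R (prev b)
    B′ = least (here refl) λ x∈ → Sum.[ (λ { refl → inj₁ refl }) ,
      (λ (x∈P₂ , _) → inj₂ (≺-≼-trans <ᶻ-isStrictTotalOrder (prev-<ᶻ b) (bound B x∈P₂))) ] (∈-replace⁻ x∈)

    after : ∀ {x} → x ∈ R → t <ᵐ x
    after x∈ with ∈-replace⁻ {t} {prev b} {cells P₂} x∈
    ... | inj₁ refl = ≼-≺-trans <ᵐ-isStrictTotalOrder (bound D (member B)) (<ᵐ-prev b)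
    ... | inj₂ (x∈P₂ , x≢t) with bound D x∈P₂
    ...   | inj₁ t≡x = contradiction (sym t≡x) x≢t
    ...   | inj₂ t<x = t<x

    K : Cut _<ᵐ_ ℓ m (cells P₁) R
    K = record
      { uniqueˡ = unique P₁
      ; uniqueʳ = replace-unique (unique P₂) prev-b∉
      ; sizeˡ   = size P₁
      ; sizeʳ   = trans (replace-length {d = prev b} (unique P₂) (member D)) (size P₂)
      ; before  = λ x∈ y∈ → before′ (bound C x∈) (after y∈)
      }
      where
      before′ : ∀ {x y} → t ≡ x ⊎ x <ᵐ t → t <ᵐ y → x <ᵐ y
      before′ (inj₁ refl) q = q
      before′ (inj₂ p)    q = M.trans p q

    -- Paths in `P₂` survive the removal of `t`, because `P₁` supplies that cell.
    P₂⊆ : cells P₂ ⊆ cells P₁ ++ R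
    P₂⊆ {x} x∈ with x ≟ᶜ t
    ... | yes refl = ∈-++⁺ˡ (member C)
    ... | no  x≢t  = ∈-++⁺ʳ (cells P₁) (∈-replace⁺ {t} {prev b} {cells P₂} x∈ x≢t)

    hub : ∀ {x} → x ∈ cells P₁ ++ R → Star (AdjacentIn (cells P₁ ++ R)) t x
    hub x∈ with ∈-++⁻ (cells P₁) x∈
    ... | inj₁ x∈P₁ = reach P₁ ∈-++⁺ˡ (member C) x∈P₁
    ... | inj₂ x∈R with ∈-replace⁻ {t} {prev b} {cells P₂} x∈R
    ...   | inj₁ refl       = reach P₂ P₂⊆ (member D) (member B) ◅◅
                              (P₂⊆ (member B) , x∈ , neighbour⇒adjacent left) ◅ ε
    ...   | inj₂ (x∈P₂ , _) = reach P₂ P₂⊆ (member D) x∈P₂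

  -- With a cell of `P₁` below `b`, `prepend` would violate `WitnessM`. So the last cell `a₀` of
  -- `P₁` moves to `b`, and `P₂` is translated to begin at `a₀`. Read from left to right, the merged
  -- row now starts with `b`, which rests on `across b` as `WitnessZ` demands.
  beside : ∀ {b t} → Least _<ᶻ_ (cells P₂) b → Up b → Least _<ᵐ_ (cells P₂) t →
           Greatest _<ᵐ_ (cells P₁) (next t) → Flat up (cells P₁) (row (next t)) → across b ∈ cells P₁ →
           Combination P₁ P₂
  beside {b} {t} B ub D C F p =
    let (a , A′) = topRight {L = L} (here refl) ; (_ , D′) = bottomRight (member B′)
        a~b = greatest-rows A′ C′
        ua = flatᴸ (member A′) a~b
    in glue <ᶻ-isStrictTotalOrder K (hub-connected hub) ,
       zigzag K (id , id) record { isTopLeft = C′ ; isTopRight = A′ ; isBottomLeft = B′ ; isBottomRight = D′ }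
         (inj₂ (trans a~b (sym a₀~b) , inj₁ (ub , across-b∈)))
         (swapˡ (trans a~b (sym a₀~b)) ua ua₀)
         (placed-≋ placed-refl (≋-sym (replace-undo (member A) b∉)))
         (placed-place (shift b a₀) P₂)
    where
    a₀ = proj₁ (topRight (member C))

    A : Greatest _<ᶻ_ (cells P₁) a₀
    A = proj₂ (topRight (member C))

    b~t : row b ≡ row (next t)
    b~t = trans (least-rows B D) (sym (row-next t))

    a₀~b : row a₀ ≡ row b
    a₀~b = trans (greatest-rows A C) (sym b~t)

    ua₀ : Up a₀
    ua₀ = F (member A) (greatest-rows A C)

    P₂′ = place (shift b a₀) P₂

    B′ : Least _<ᶻ_ (cells P₂′) a₀
    B′ = least-place translate-<ᶻ P₂ (trans ub (sym ua₀)) B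

    L = replace a₀ b (cells P₁)

    flatᴸ : Flat up L (row b)
    flatᴸ x∈ e with ∈-replace⁻ {a₀} {b} {cells P₁} x∈
    ... | inj₁ refl       = ub
    ... | inj₂ (x∈P₁ , _) = F x∈P₁ (trans e b~t)

    b∉ : b ∉ cells P₁
    b∉ b∈ = M.irrefl refl (sandwich <ᵐ-isStrictTotalOrder C (next-<ᵐ t) D b∈ (member B))

    b<a₀ : b <ᶻ a₀
    b<a₀ = ≼-≺-trans <ᶻ-isStrictTotalOrder (bound B (member D)) (next≤ (bound A (member C)))
      where
      next≤ : ∀ {z} → z ≡ next t ⊎ next t <ᶻ z → t <ᶻ z
      next≤ (inj₁ refl) = <ᶻ-next t
      next≤ (inj₂ q)    = Z.trans (<ᶻ-next t) q

    -- The supporting cell is a down cell, so it is not the removed up cell `a₀`.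
    across-b∈ : across b ∈ L
    across-b∈ = ∈-replace⁺ p λ e →
      up≢down ua₀ (trans (cong orient (sym e)) (trans (orient-across b) (opposite-up ub)))

    C′ : Greatest _<ᵐ_ L b
    C′ = least (here refl) λ x∈ → Sum.[ (λ { refl → inj₁ refl }) ,
      (λ (x∈P₁ , _) → inj₂ (sandwich <ᵐ-isStrictTotalOrder C (next-<ᵐ t) D x∈P₁ (member B))) ] (∈-replace⁻ x∈)

    K : Cut _<ᶻ_ ℓ m L (cells P₂′)
    K = record
      { uniqueˡ = replace-unique (unique P₁) b∉
      ; uniqueʳ = unique P₂′
      ; sizeˡ   = trans (replace-length {d = b} (unique P₁) (member A)) (size P₁)
      ; sizeʳ   = size P₂′
      ; before  = λ x∈ y∈ → ≺-≼-trans <ᶻ-isStrictTotalOrder (below (∈-replace⁻ x∈)) (bound B′ y∈)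
      }
      where
      below : ∀ {x} → x ≡ b ⊎ (x ∈ cells P₁ × x ≢ a₀) → x <ᶻ a₀
      below (inj₁ refl) = b<a₀
      below (inj₂ (x∈ , x≢)) with bound A x∈
      ... | inj₁ e = contradiction (sym e) x≢
      ... | inj₂ q = q

    -- The cell `a₀` taken from `P₁` is restored by the translated `P₂`, so paths in `P₁` survive.
    P₁⊆ : cells P₁ ⊆ L ++ cells P₂′
    P₁⊆ {x} x∈ with x ≟ᶜ a₀
    ... | yes refl = ∈-++⁺ʳ L (member B′)
    ... | no  x≢   = ∈-++⁺ˡ (∈-replace⁺ x∈ x≢)

    hub : ∀ {x} → x ∈ L ++ cells P₂′ → Star (AdjacentIn (L ++ cells P₂′)) a₀ x
    hub x∈ with ∈-++⁻ L x∈
    ... | inj₂ x∈P₂ = reach P₂′ (∈-++⁺ʳ L) (member B′) x∈P₂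
    ... | inj₁ x∈L with ∈-replace⁻ {a₀} {b} {cells P₁} x∈L
    ...   | inj₁ refl       = reach P₁ P₁⊆ (member A) p ◅◅
                              (P₁⊆ p , x∈ , adjacent-sym (neighbour⇒adjacent outward)) ◅ ε
    ...   | inj₂ (x∈P₁ , _) = reach P₁ P₁⊆ (member A) x∈P₁

-- The right end `t` of the bottom row of `P₂` decides: `P₁` starts at `t` if that is an up cell,
-- and otherwise at the up cell after it. In the latter case a cell of `P₁` below `b` calls for
-- `beside`.
precede : ∀ {ℓ m} (P₁ : Polyiamond ℓ) (P₂ : Polyiamond m) → 2 ≤ m →
          ∀ {a} → Greatest _<ᶻ_ (cells P₁) a → Flat up (cells P₁) (row a) →
          ∀ {b} → Least _<ᶻ_ (cells P₂) b → Up b → Combination P₁ P₂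
precede P₁ P₂ 2≤m A F {b} B ub =
  let (c , C) = topLeft (member A) ; (t , D) = bottomRight (member B)
  in attach C (λ x∈ e → F x∈ (trans e (greatest-rows C A))) D
  where
  attach : ∀ {c t} → Greatest _<ᵐ_ (cells P₁) c → Flat up (cells P₁) (row c) → Least _<ᵐ_ (cells P₂) t →
           Combination P₁ P₂
  attach {c} {t@(_ , up)} C F D =
    let uc = F (member C) refl
        (Q , out) = overlay (place (shift c t) P₁) P₂ 2≤m B ub D
                      (least-place {_≺_ = flip _<ᵐ_} (λ u → translate-<ᵐ u) P₁ uc C)
                      (flat-place P₁ {a = c} {t} uc F)
    in Q , outcome-placed (placed-place (shift c t) P₁) placed-refl out
  attach {c} {t@(_ , down)} C F D with across b ∈? cells (place (shift c (next t)) P₁)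
  ... | yes p =
    let uc = F (member C) refl
        (Q , out) = beside (place (shift c (next t)) P₁) P₂ B ub D
                      (least-place {_≺_ = flip _<ᵐ_} (λ u → translate-<ᵐ u) P₁ uc C)
                      (flat-place P₁ {a = c} {next t} uc F) p
    in Q , outcome-placed (placed-place (shift c (next t)) P₁) placed-refl out
  ... | no ¬p =
    let uc = F (member C) refl
        (Q , out) = prepend (place (shift c (next t)) P₁) P₂ B ub D
                      (least-place {_≺_ = flip _<ᵐ_} (λ u → translate-<ᵐ u) P₁ uc C)
                      (flat-place P₁ {a = c} {next t} uc F) ¬p refl
    in Q , outcome-placed (placed-place (shift c (next t)) P₁) placed-refl out

-- This is `precede` seen after a half turn, which exchanges the two polyiamonds as well as up and
-- down.
succeed : ∀ {ℓ m} (P₁ : Polyiamond ℓ) (P₂ : Polyiamond m) → 2 ≤ ℓ →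
          ∀ {a} → Greatest _<ᶻ_ (cells P₁) a → Down a →
          ∀ {b} → Least _<ᶻ_ (cells P₂) b → Flat down (cells P₂) (row b) → Combination P₁ P₂
succeed {ℓ} {m} P₁ P₂ 2≤ℓ {a} A va {b} B F =
  let (Q , out) = precede (turned P₂) (turned P₁) 2≤ℓ (least-map (turn 0ᵖ) (turn-<ᶻ 0ᵖ) B) F′
                    (least-map (turn 0ᵖ) (turn-<ᶻ 0ᵖ) A) (opposite-down va)
  in record { Polyiamond (turned Q) ; size = trans (size (turned Q)) (ℕ.+-comm m ℓ) } ,
     subst₂ (λ P P′ → Outcome ℓ m P P′ (cells (turned Q)))
       (map-turn-involutive 0ᵖ (cells P₁)) (map-turn-involutive 0ᵖ (cells P₂))
       (outcome-turn 0ᵖ out)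
  where
  F′ : Flat up (map (turn 0ᵖ) (cells P₂)) (row (turn 0ᵖ b))
  F′ x∈ e with ∈-map⁻ (turn 0ᵖ) {xs = cells P₂} x∈
  ... | x , x∈P₂ , refl = opposite-down (F x∈P₂ (trans
    (sym (cong row (turn-involutive 0ᵖ x)))
    (trans (turn-row-≡ 0ᵖ {turn 0ᵖ b} {turn 0ᵖ x} (sym e)) (cong row (turn-involutive 0ᵖ b)))))

-- Case distinction on the two facing rows

some-cell : ∀ {n} (P : Polyiamond n) → 1 ≤ n → ∃ (_∈ cells P)
some-cell P 1≤n with cells P | size P
some-cell P () | [] | refl
... | c ∷ _ | _ = c , here refl

top-cell : ∀ {n} (P : Polyiamond n) {a x} → Greatest _<ᶻ_ (cells P) a → x ∈ cells P → row x ≡ row a →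
           Least Above (cells P) x
top-cell P A x∈ e = least x∈ λ y∈ → inj₂ (subst (_ ℤ.≤_) (sym e) (greatest-row A y∈))

bottom-cell : ∀ {n} (P : Polyiamond n) {b y} → Least _<ᶻ_ (cells P) b → y ∈ cells P → row y ≡ row b →
              Least (flip Above) (cells P) y
bottom-cell P B y∈ e = least y∈ λ z∈ → inj₂ (subst (ℤ._≤ _) (sym e) (least-row B z∈))

compose : ∀ {ℓ m} → 2 ≤ ℓ → 2 ≤ m → (P₁ : Polyiamond ℓ) (P₂ : Polyiamond m) → Combination P₁ P₂
compose 2≤ℓ 2≤m P₁ P₂ =
  let (a , A) = topRight (proj₂ (some-cell P₁ (ℕ.<⇒≤ 2≤ℓ)))
      (b , B) = bottomLeft (proj₂ (some-cell P₂ (ℕ.<⇒≤ 2≤m)))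
  in choose A B (flat? up (cells P₁) (row a)) (flat? down (cells P₂) (row b))
  where
  adjoin : ∀ {a b} → Greatest _<ᶻ_ (cells P₁) a → Least _<ᶻ_ (cells P₂) b → Up a → Down b →
           Flat up (cells P₁) (row a) ⊎ Flat down (cells P₂) (row b) → Combination P₁ P₂
  adjoin {a} {b} A B ua vb F =
    let ua′ = trans ua (sym (trans (orient-prev b) (opposite-down vb)))
        (Q , out) = append (place (shift a (prev b)) P₁) P₂ 2≤ℓ 2≤m
          (least-place {_≺_ = flip _<ᶻ_} (λ u → translate-<ᶻ u) P₁ ua′ A)
          B (sym (next-prev b)) (trans (orient-prev b) (opposite-down vb))
          (Sum.map₁ (flat-place P₁ {a = a} {prev b} ua′) F)
    in Q , outcome-placed (placed-place (shift a (prev b)) P₁) placed-refl out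

  choose : ∀ {a b} → Greatest _<ᶻ_ (cells P₁) a → Least _<ᶻ_ (cells P₂) b →
    Flat up (cells P₁) (row a) ⊎ (∃ λ x → x ∈ cells P₁ × row x ≡ row a × orient x ≢ up) →
    Flat down (cells P₂) (row b) ⊎ (∃ λ y → y ∈ cells P₂ × row y ≡ row b × orient y ≢ down) →
    Combination P₁ P₂
  choose {a} {b} A B (inj₁ F) (inj₁ G) = adjoin A B (F (member A) refl) (G (member B) refl) (inj₁ F)
  choose {a} {b} A B (inj₁ F) (inj₂ _) with orient b in ob
  ... | up   = precede P₁ P₂ 2≤m A F B ob
  ... | down = adjoin A B (F (member A) refl) ob (inj₁ F)
  choose {a} {b} A B (inj₂ _) (inj₁ G) with orient a in oa
  ... | up   = adjoin A B oa (G (member B) refl) (inj₂ G)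
  ... | down = succeed P₁ P₂ 2≤ℓ A oa B G
  -- Neither row is flat in the required way, so there are a down cell at the top of `P₁` and an up
  -- cell at the bottom of `P₂` to stack along.
  choose A B (inj₂ (x , x∈ , x~a , ¬ux)) (inj₂ (y , y∈ , y~b , ¬vy)) =
    let vx = ≢up⇒down ¬ux
        vy = trans (orient-across y) (opposite-up (≢down⇒up ¬vy))
        (Q , out) = stack (place (shift x (across y)) P₁) P₂
          (least-place {_≺_ = Above} (λ u {c} {d} → translate-Above u {c} {d}) P₁
            (trans vx (sym vy)) (top-cell P₁ A x∈ x~a)) vy
          (subst (Least (flip Above) (cells P₂)) (sym (across-across y)) (bottom-cell P₂ B y∈ y~b))
    in Q , outcome-placed (placed-place (shift x (across y)) P₁) placed-refl out

compose-injective : ∀ {ℓ m} (2≤ℓ : 2 ≤ ℓ) (2≤m : 2 ≤ m) (P₁ P₁′ : Polyiamond ℓ) (P₂ P₂′ : Polyiamond m) →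
  proj₁ (compose 2≤ℓ 2≤m P₁ P₂) ≈ proj₁ (compose 2≤ℓ 2≤m P₁′ P₂′) → P₁ ≈ P₁′ × P₂ ≈ P₂′
compose-injective 2≤ℓ 2≤m P₁ P₁′ P₂ P₂′ eq =
  let (Q , out) = compose 2≤ℓ 2≤m P₁ P₂ ; (Q′ , out′) = compose 2≤ℓ 2≤m P₁′ P₂′
  in outcome-injective {P₁ = P₁} {P₁′} {P₂} {P₂′} (outcome-≈ {Q = Q} {Q′} out eq) out′

-- Counting by injections

*-T-≤ : ∀ {k m n} (f : Fin k → Polyiamond m → Polyiamond n) →
        (∀ i j P P′ → f i P ≈ f j P′ → i ≡ j × P ≈ P′) → k * T m ≤ T n
*-T-≤ {k} {m} {n} f f-inj = injective⇒≤ {f = g} g-injective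
  where
  module Tm = Bijection (T-counts m)
  module Tn = Bijection (T-counts n)

  -- Only the chosen representatives `Tm.to j` are fed to `f`, so it suffices that `f` reflects `≈`.
  h : Fin (k * T m) → Polyiamond n
  h x = let (i , j) = remQuot {k} (T m) x in f i (Tm.to j)

  g : Fin (k * T m) → Fin (T n)
  g x = proj₁ (Tn.strictlySurjective (h x))

  h≈ : ∀ x → Tn.to (g x) ≈ h x
  h≈ x = proj₂ (Tn.strictlySurjective (h x))

  g-injective : ∀ {x y} → g x ≡ g y → x ≡ y
  g-injective {x} {y} gx≡gy =
    let (i≡ , P≈) = f-inj _ _ _ _ (≈-trans {P = h x} {Tn.to (g x)} {h y}
                      (≈-sym {P = Tn.to (g x)} {h x} (h≈ x))
                      (subst (λ z → Tn.to z ≈ h y) (sym gx≡gy) (h≈ y)))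
    in trans (sym (combine-remQuot {k} (T m) x))
         (trans (cong₂ combine i≡ (Tm.injective P≈)) (combine-remQuot {k} (T m) y))

-- Adding a single cell

-- The orientation is a label for the two ways of enlarging, standing for the two elements counted
-- by `T 1`; it is not the orientation of the added cell.
data Outcome₁ {m} (P : Polyiamond m) (Q : List Cell) : Orientation → Set where
  leading : ∀ (P′ : Polyiamond m) {b} → Placed (cells P) (cells P′) → Least _<ᶻ_ (cells P′) b →
            prev b ∷ cells P′ ≋ Q → Outcome₁ P Q up
  beneath : ∀ (P′ : Polyiamond m) {y} → Placed (cells P) (cells P′) → Least (flip Above) (cells P′) y → Up y →
            across y ∷ cells P′ ≋ Q → Outcome₁ P Q down
  after   : ∀ (P′ : Polyiamond m) {d} → Placed (cells P) (cells P′) → Least _<ᵐ_ (cells P′) d →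
            Flat down (cells P′) (row d) → next d ∷ cells P′ ≋ Q → Outcome₁ P Q down

grow : ∀ {n} (P : Polyiamond n) {c d} → c ∈ cells P → Neighbour c d → d ∉ cells P → Polyiamond (suc n)
grow P c∈ n d∉ = extend P _ d∉ (lose c∈ (neighbour⇒adjacent n))

enlarge : ∀ {m} → 2 ≤ m → ∀ o (P : Polyiamond m) → Σ[ Q ∈ Polyiamond (suc m) ] Outcome₁ P (cells Q) o
enlarge 2≤m o P = choose o (proj₂ (bottomLeft (proj₂ (some-cell P (ℕ.<⇒≤ 2≤m)))))
  where
  choose : ∀ o {b} → Least _<ᶻ_ (cells P) b → Σ[ Q ∈ Polyiamond _ ] Outcome₁ P (cells Q) o
  choose up {b} B =
    grow P (member B) left (not-less <ᶻ-isStrictTotalOrder B (prev-<ᶻ b)) , leading P placed-refl B (id , id)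
  choose down {b} B with flat? down (cells P) (row b)
  ... | inj₁ F = let (d , D) = bottomRight (member B) in
    grow P (member D) right (not-less <ᵐ-isStrictTotalOrder D (next-<ᵐ d)) ,
    after P placed-refl D (λ x∈ e → F x∈ (trans e (least-rows D B))) (id , id)
  ... | inj₂ (y , y∈ , y~b , ¬vy) =
    grow P y∈ outward (not-less <ᶻ-isStrictTotalOrder B
      (lower (subst (row (across y) ℤ.<_) y~b (row-across-up uy)))) ,
    beneath P placed-refl (bottom-cell P B y∈ y~b) uy (id , id)
    where uy = ≢down⇒up ¬vy

outcome₁-≈ : ∀ {m n o} {P : Polyiamond m} {Q Q′ : Polyiamond n} → Outcome₁ P (cells Q) o → Q ≈ Q′ →
             Outcome₁ P (cells Q′) o
outcome₁-≈ {P = P} {Q} {Q′} out (v , f) = move out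
  where
  moved : ∀ {xs} → xs ≋ cells Q → map (translate v) xs ≋ cells Q′
  moved {xs} (to , from) = to′ , from′
    where
    to′ : map (translate v) xs ⊆ cells Q′
    to′ x∈ with ∈-map⁻ (translate v) {xs = xs} x∈
    ... | c , c∈ , refl = Equivalence.to (f c) (to c∈)

    from′ : cells Q′ ⊆ map (translate v) xs
    from′ {c} c∈ = subst (_∈ _) (translate-⊖ʳ v c) (∈-map⁺ (translate v)
      (from (Equivalence.from (f _) (subst (_∈ cells Q′) (sym (translate-⊖ʳ v c)) c∈))))

  rename : ∀ {c c′ xs ys} → c ≡ c′ → c ∷ xs ≋ ys → c′ ∷ xs ≋ ys
  rename refl eq = eq

  move : ∀ {o} → Outcome₁ P (cells Q) o → Outcome₁ P (cells Q′) o
  move (leading P′ {b} p B eq) = leading (place v P′) (placed-trans p (placed-place v P′))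
    (least-map (translate v) (translate-<ᶻ v) B) (rename (translate-prev v b) (moved eq))
  move (beneath P′ {y} p Y u eq) = beneath (place v P′) (placed-trans p (placed-place v P′))
    (least-map (translate v) (λ {c} {d} → translate-Above v {d} {c}) Y) u
    (rename (translate-across v y) (moved eq))
  move (after P′ {d} p D F eq) = after (place v P′) (placed-trans p (placed-place v P′))
    (least-map (translate v) (translate-<ᵐ v) D) F′ (rename (translate-next v d) (moved eq))
    where
    F′ : Flat down (cells (place v P′)) (row (translate v d))
    F′ x∈ e with ∈-map⁻ (translate v) {xs = cells P′} x∈
    ... | x , x∈P′ , refl = F x∈P′ (translate-row-≡⁻ v {x} {d} e)

module _ {m} (P : Polyiamond m) where

  lone-cut : ∀ {_≺_ : Rel Cell 0ℓ} {c} → (∀ {y} → y ∈ cells P → c ≺ y) → Cut _≺_ 1 m (c ∷ []) (cells P)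
  lone-cut before = cells-cut (single _) P λ { (here refl) → before }

  lone-corners : ∀ {c b d} → Least _<ᶻ_ (cells P) b → Least _<ᵐ_ (cells P) d →
                 Corners (c ∷ []) (cells P) c c b d
  lone-corners B D = record { isTopLeft = alone ; isTopRight = alone ; isBottomLeft = B ; isBottomRight = D }
    where
    alone : ∀ {_≺_ : Rel Cell 0ℓ} {c} → Least _≺_ (c ∷ []) c
    alone = least (here refl) λ { (here refl) → inj₁ refl }

  before-cut : ∀ {b} → Least _<ᶻ_ (cells P) b → Cut _<ᶻ_ 1 m (prev b ∷ []) (cells P)
  before-cut {b} B = lone-cut λ y∈ → ≺-≼-trans <ᶻ-isStrictTotalOrder (prev-<ᶻ b) (bound B y∈)

  beneath-row : ∀ {y z} → Least (flip Above) (cells P) y → Up y → z ∈ cells P → row (across y) ℤ.< row z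
  beneath-row Y u z∈ with bound Y z∈
  ... | inj₁ refl = row-across-up u
  ... | inj₂ y≤z  = ℤ.<-≤-trans (row-across-up u) y≤z

  beneath-cut : ∀ {y} → Least (flip Above) (cells P) y → Up y → Cut _<ᶻ_ 1 m (across y ∷ []) (cells P)
  beneath-cut Y u = lone-cut λ z∈ → lower (beneath-row Y u z∈)

  after-cut : ∀ {d} → Least _<ᵐ_ (cells P) d → Cut _<ᵐ_ 1 m (next d ∷ []) (cells P)
  after-cut {d} D = lone-cut λ y∈ → ≺-≼-trans <ᵐ-isStrictTotalOrder (next-<ᵐ d) (bound D y∈)

module _ {m} (P P′ : Polyiamond m) where

  -- Both cuts are for `<ᶻ`, so they would agree; but `prev b` shares a row with `b`, whereas
  -- `across y` lies below all of `P′`.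
  before-beneath-⊥ : ∀ {b y Q} → Least _<ᶻ_ (cells P) b → prev b ∷ cells P ≋ Q →
    Least (flip Above) (cells P′) y → Up y → across y ∷ cells P′ ≋ Q → ⊥
  before-beneath-⊥ {b} B eq Y u eq′ =
    let (eqL , eqR) = cut-unique <ᶻ-isStrictTotalOrder (before-cut P B) (beneath-cut P′ Y u)
                        (≋-trans eq (≋-sym eq′))
    in clash eqL eqR
    where
    clash : (prev b ∷ []) ≋ (across _ ∷ []) → cells P ≋ cells P′ → ⊥
    clash (f , _) (g , _) with f (here refl)
    ... | here e = ℤ.<-irrefl (trans (sym (cong row e)) (row-prev b)) (beneath-row P′ Y u (g (member B)))

  -- The cut under `P′` separates rows, while `next d` shares a row with `P`.
  after-beneath-⊥ : ∀ {d y Q} → Least _<ᵐ_ (cells P) d → next d ∷ cells P ≋ Q →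
    Least (flip Above) (cells P′) y → Up y → across y ∷ cells P′ ≋ Q → ⊥
  after-beneath-⊥ {d} D eq Y u eq′ =
    let (_ , B) = bottomLeft (member D)
        (_ , B′) = bottomLeft (member Y)
        (_ , D′) = bottomRight (member Y)
    in mixed-≮ (after-cut P D) (beneath-cut P′ Y u) (lone-corners P B D) (lone-corners P′ B′ D′)
         (≋-trans eq (≋-sym eq′)) (trans (row-next d) (least-rows D B)) (beneath-row P′ Y u (member B′))

  -- The added cell `prev b′` would be the left end of the flat row of `P`, a down cell, which makes
  -- `b′` an up cell. The only up cell left in that row is `next d`, its right end; but `P′` also
  -- contains `next b′`, further to the right.
  after-before-⊥ : 2 ≤ m → ∀ {d b Q} → Least _<ᵐ_ (cells P) d → Flat down (cells P) (row d) →
    next d ∷ cells P ≋ Q → Least _<ᶻ_ (cells P′) b → prev b ∷ cells P′ ≋ Q → ⊥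
  after-before-⊥ 2≤m {d} {b′} D F eq B′ eq′ =
    let (_ , B) = bottomLeft (member D) ; (_ , D′) = bottomRight (member B′)
        eqQ = ≋-trans eq (≋-sym eq′)
        a≡b = trans (row-next d) (least-rows D B)
        leftmost = mixed-leftmost (after-cut P D) (before-cut P′ B′)
                     (lone-corners P B D) (lone-corners P′ B′ D′)
                     eqQ a≡b (row-prev b′)
        vb = F (member B) (sym (least-rows D B))
        b′~d = trans (sym (row-prev b′)) (trans (cong row leftmost) (sym (least-rows D B)))
        ub′ = trans (cong orient (sym (next-prev b′))) (trans (orient-next (prev b′))
                (opposite-down (trans (cong orient leftmost) vb)))
    in clash ub′ b′~d (proj₂ eqQ (there (member B′))) (proj₂ eqQ (there (next-of-bottomLeft P′ 2≤m B′ ub′)))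
    where
    clash : Up b′ → row b′ ≡ row d → b′ ∈ next d ∷ cells P → next b′ ∈ next d ∷ cells P → ⊥
    clash ub′ b′~d (there b′∈) _ = up≢down ub′ (F b′∈ b′~d)
    clash _ _ (here refl) (here e) = ◁-irrefl (subst (next d ◁_) e (◁-next (next d)))
    clash _ _ (here refl) (there p) = not-less <ᵐ-isStrictTotalOrder D (M.trans (next-<ᵐ (next d)) (next-<ᵐ d)) p

outcome₁-injective : ∀ {m} → 2 ≤ m → ∀ {o o′} {P P′ : Polyiamond m} {Q} →
                     Outcome₁ P Q o → Outcome₁ P′ Q o′ → o ≡ o′ × P ≈ P′
outcome₁-injective 2≤m {P = P₀} {P₀′} (leading P p B eq) (leading P′ p′ B′ eq′) =
  refl , placed-≈ {P = P₀} {P₀′} (placed-≋ p (proj₂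
    (cut-unique <ᶻ-isStrictTotalOrder (before-cut P B) (before-cut P′ B′) (≋-trans eq (≋-sym eq′))))) p′
outcome₁-injective 2≤m {P = P₀} {P₀′} (beneath P p Y u eq) (beneath P′ p′ Y′ u′ eq′) =
  refl , placed-≈ {P = P₀} {P₀′} (placed-≋ p (proj₂
    (cut-unique <ᶻ-isStrictTotalOrder (beneath-cut P Y u) (beneath-cut P′ Y′ u′) (≋-trans eq (≋-sym eq′))))) p′
outcome₁-injective 2≤m {P = P₀} {P₀′} (after P p D _ eq) (after P′ p′ D′ _ eq′) =
  refl , placed-≈ {P = P₀} {P₀′} (placed-≋ p (proj₂
    (cut-unique <ᵐ-isStrictTotalOrder (after-cut P D) (after-cut P′ D′) (≋-trans eq (≋-sym eq′))))) p′
outcome₁-injective _ (leading P _ B eq) (beneath P′ _ Y u eq′) = ⊥-elim (before-beneath-⊥ P P′ B eq Y u eq′)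
outcome₁-injective _ (beneath P _ Y u eq) (leading P′ _ B eq′) = ⊥-elim (before-beneath-⊥ P′ P B eq′ Y u eq)
outcome₁-injective _ (after P _ D _ eq) (beneath P′ _ Y u eq′) = ⊥-elim (after-beneath-⊥ P P′ D eq Y u eq′)
outcome₁-injective _ (beneath P _ Y u eq) (after P′ _ D _ eq′) = ⊥-elim (after-beneath-⊥ P′ P D eq′ Y u eq)
outcome₁-injective h (after P _ D F eq) (leading P′ _ B eq′) = ⊥-elim (after-before-⊥ P P′ h D F eq B eq′)
outcome₁-injective h (leading P _ B eq) (after P′ _ D F eq′) = ⊥-elim (after-before-⊥ P′ P h D F eq′ B eq)

-- The inequality

orientation : Fin 2 → Orientation
orientation zero    = up
orientation (suc _) = down

orientation-injective : ∀ i j → orientation i ≡ orientation j → i ≡ j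
orientation-injective zero       zero       _ = refl
orientation-injective (suc zero) (suc zero) _ = refl

T1*T≤ : ∀ m → 2 ≤ m → T 1 * T m ≤ T (1 + m)
-- `T 1` evaluates to 2.
T1*T≤ m 2≤m = *-T-≤ {2} (λ i P → proj₁ (enlarge 2≤m (orientation i) P)) λ i j P P′ eq →
  let (Q , out) = enlarge 2≤m (orientation i) P ; (Q′ , out′) = enlarge 2≤m (orientation j) P′
      (o≡ , P≈) = outcome₁-injective 2≤m {P = P} {P′} (outcome₁-≈ {P = P} {Q} {Q′} out eq) out′
  in orientation-injective i j o≡ , P≈

T*T≤ : ∀ ℓ m → 2 ≤ ℓ → 2 ≤ m → T ℓ * T m ≤ T (ℓ + m)
T*T≤ ℓ m 2≤ℓ 2≤m = *-T-≤ {T ℓ} (λ i P → proj₁ (compose 2≤ℓ 2≤m (Tℓ.to i) P)) λ i j P P′ eq →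
  let (i≈j , P≈P′) = compose-injective 2≤ℓ 2≤m (Tℓ.to i) (Tℓ.to j) P P′ eq in Tℓ.injective i≈j , P≈P′
  where module Tℓ = Bijection (T-counts ℓ)

theorem4 : ∀ (ℓ m : ℕ) → 1 ≤ ℓ → 1 ≤ m → ¬ (ℓ ≡ 1 × m ≡ 1) → T (ℓ + m) ≥ T ℓ * T m
theorem4 1               1               _ _ ¬11 = contradiction (refl , refl) ¬11
theorem4 1               m@(suc (suc _)) _ _ _ = T1*T≤ m (s≤s (s≤s z≤n))
theorem4 ℓ@(suc (suc _)) 1               _ _ _ =
  subst₂ _≤_ (ℕ.*-comm (T 1) (T ℓ)) (cong T (ℕ.+-comm 1 ℓ)) (T1*T≤ ℓ (s≤s (s≤s z≤n)))
theorem4 ℓ@(suc (suc _)) m@(suc (suc _)) _ _ _ = T*T≤ ℓ m (s≤s (s≤s z≤n)) (s≤s (s≤s z≤n))
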